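{- Let $I,J\subseteq\mathbb{R}$ be open intervals and let $f:I\to J$ and $g:J\to\mathbb{R}$ be infinitely differentiable. Let $F^{\Delta}(n,k,x)$ be the composita of $f(x+z)-f(x)$ for $x\in I$, and let $G^{\Delta}(n,k,u)$ be the composita of $g(u+z)-g(u)$ for $u\in J$. Then for the composition $y(x)=g(f(x))$, the composita of the generating function $Y(x,z)=g(f(x+z))-g(f(x))$ is $$Y^{\Delta}(n,m,x)=\sum_{k=m}^{n}F^{\Delta}(n,k,x)\,G^{\Delta}(k,m,f(x))$$ for all integers $n\ge m\ge 1$ and all $x\in I$.
   Context: For an infinitely differentiable function $h$, the expression $h(x+z)-h(x)$ denotes the formal power series $\sum_{n\ge 1}\frac{h^{(n)}(x)}{n!}z^n$ in $z$. Its composita is the array $$H^{\Delta}(n,k,x)=\sum_{\substack{\lambda_1+\cdots+\lambda_k=n\\ \lambda_1,\dots,\lambda_k\ge 1}}\frac{h^{(\lambda_1)}(x)}{\lambda_1!}\cdots\frac{h^{(\lambda_k)}(x)}{\lambda_k!},\qquad n\ge k\ge 1,$$ the sum being over all compositions of $n$ into exactly $k$ positive parts; equivalently, $[h(x+z)-h(x)]^k=\sum_{n\ge k}H^{\Delta}(n,k,x)z^n$. In the claim, $Y(x,z)=y(x+z)-y(x)$, that is, $Y^{\Delta}$ is this array for $h=y=g\circ f$. -}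

module Defs where

open import Level using (0ℓ)
open import Data.Nat as ℕ using (ℕ; zero; suc; _∸_; _!)
import Data.Nat.Properties as ℕ
open import Data.Integer using (+_)
open import Data.Rational as ℚ using (ℚ; 0ℚ; 1ℚ; ½)
import Data.Rational.Properties as ℚ
open import Data.Rational.Solver using (module +-*-Solver)
open import Data.List as List using (List; []; _∷_; upTo; concatMap)
open import Data.Vec as Vec using (Vec; []; _∷_)
open import Data.Maybe using (Maybe)
open import Data.Maybe.Relation.Unary.All using (All)
open import Data.Product using (∃; _×_; _,_; proj₁)
open import Data.Sum using (_⊎_; inj₁; inj₂)
open import Function using (Func; id)
open import Function.Construct.Composition using (function)
open import Relation.Binary using (Setoid; IsEquivalence)
open import Relation.Binary.PropositionalEquality
  using (_≡_; _≢_; refl; sym; trans; cong; cong₂; subst; subst₂)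
import Relation.Binary.Construct.On as On
open import Relation.Nullary using (yes; no; contradiction)

infix  4 _≈_ _<_ _#_ _∈_
infixl 6 _+_ _-_
infixl 7 _*_
infix  8 -_
infixr 9 _∘_

Eventually : (ℕ → Set) → Set
Eventually P = ∃ λ N → ∀ n → N ℕ.≤ n → P n

CloseTail : (ℕ → ℚ) → ℚ → Set
CloseTail s ε = ∃ λ N → ∀ m n → N ℕ.≤ m → N ℕ.≤ n → ℚ.∣ s m ℚ.- s n ∣ ℚ.< ε

Cauchy : (ℕ → ℚ) → Set
Cauchy s = ∀ ε → 0ℚ ℚ.< ε → CloseTail s ε

-- The real numbers: Cauchy sequences of rationals, considered up to _≈_.
record ℝ : Set where
  constructor mkℝ
  field
    seq    : ℕ → ℚ
    cauchy : Cauchy seq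

open ℝ public

-- _≈_ and _<_ are records, rather than functions into Set, so that x and y
-- can be inferred from a proof of x ≈ y or x < y.
record _≈_ (x y : ℝ) : Set where
  constructor mk≈
  field
    converge : ∀ ε → 0ℚ ℚ.< ε →
               Eventually λ n → ℚ.∣ seq x n ℚ.- seq y n ∣ ℚ.< ε

record _<_ (x y : ℝ) : Set where
  constructor mk<
  field
    gap      : ℚ
    gap-pos  : 0ℚ ℚ.< gap
    separate : Eventually λ n → seq x n ℚ.+ gap ℚ.≤ seq y n

open _≈_ public
open _<_ public

_#_ : ℝ → ℝ → Set
x # y = x < y ⊎ y < x

-- The Cauchy and equivalence proofs are abstract only to keep them from being
-- unfolded during type checking; seq of every operation still computes.
module RealLemmas where

  module Identities where
    open +-*-Solver

    neg-minus : ∀ p q → ℚ.- (p ℚ.- q) ≡ q ℚ.- p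
    neg-minus = solve 2 (λ p q → :- (p :- q) := q :- p) refl

    minus-plus : ∀ p q → (p ℚ.- q) ℚ.+ q ≡ p
    minus-plus = solve 2 (λ p q → (p :- q) :+ q := p) refl

    plus-minus : ∀ p q → (p ℚ.+ q) ℚ.- q ≡ p
    plus-minus = solve 2 (λ p q → (p :+ q) :- q := p) refl

    plus-minusˡ : ∀ p q → (p ℚ.+ q) ℚ.- p ≡ q
    plus-minusˡ = solve 2 (λ p q → (p :+ q) :- p := q) refl

    telescope : ∀ p q r → p ℚ.- r ≡ (p ℚ.- q) ℚ.+ (q ℚ.- r)
    telescope = solve 3 (λ p q r → p :- r := (p :- q) :+ (q :- r)) refl

    plus-diff : ∀ a b c d → (a ℚ.+ b) ℚ.- (c ℚ.+ d) ≡ (a ℚ.- c) ℚ.+ (b ℚ.- d)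
    plus-diff = solve 4
      (λ a b c d → (a :+ b) :- (c :+ d) := (a :- c) :+ (b :- d)) refl

    neg-diff : ∀ p q → q ℚ.- p ≡ (ℚ.- p) ℚ.- (ℚ.- q)
    neg-diff = solve 2 (λ p q → q :- p := (:- p) :- (:- q)) refl

    times-diff : ∀ a b c d →
      a ℚ.* (b ℚ.- d) ℚ.+ d ℚ.* (a ℚ.- c) ≡ a ℚ.* b ℚ.- c ℚ.* d
    times-diff = solve 4
      (λ a b c d → a :* (b :- d) :+ d :* (a :- c) := a :* b :- c :* d) refl

    recip-diff : ∀ p q r s →
      q ℚ.* (p ℚ.* r) ℚ.- p ℚ.* (q ℚ.* s) ≡ (r ℚ.- s) ℚ.* (p ℚ.* q)
    recip-diff = solve 4
      (λ p q r s → q :* (p :* r) :- p :* (q :* s) := (r :- s) :* (p :* q)) refl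

  open Identities

  half-pos : ∀ ε → 0ℚ ℚ.< ε → 0ℚ ℚ.< ½ ℚ.* ε
  half-pos ε p = subst (ℚ._< ½ ℚ.* ε) (ℚ.*-zeroʳ ½) (ℚ.*-monoʳ-<-pos ½ p)

  half+half : ∀ ε → ½ ℚ.* ε ℚ.+ ½ ℚ.* ε ≡ ε
  half+half ε = trans (sym (ℚ.*-distribʳ-+ ε ½ ½)) (ℚ.*-identityˡ ε)

  ∣-∣-swap : ∀ p q → ℚ.∣ p ℚ.- q ∣ ≡ ℚ.∣ q ℚ.- p ∣
  ∣-∣-swap p q = trans (sym (ℚ.∣-p∣≡∣p∣ (p ℚ.- q))) (cong ℚ.∣_∣ (neg-minus p q))

  ∣p-p∣<ε : ∀ p {ε} → 0ℚ ℚ.< ε → ℚ.∣ p ℚ.- p ∣ ℚ.< ε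
  ∣p-p∣<ε p {ε} = subst (λ q → ℚ.∣ q ∣ ℚ.< ε) (sym (ℚ.+-inverseʳ p))

  ∣+∣< : ∀ p q ε → ℚ.∣ p ∣ ℚ.< ½ ℚ.* ε → ℚ.∣ q ∣ ℚ.< ½ ℚ.* ε →
         ℚ.∣ p ℚ.+ q ∣ ℚ.< ε
  ∣+∣< p q ε a b = ℚ.≤-<-trans (ℚ.∣p+q∣≤∣p∣+∣q∣ p q)
    (subst (ℚ.∣ p ∣ ℚ.+ ℚ.∣ q ∣ ℚ.<_) (half+half ε) (ℚ.+-mono-< a b))

  ∣p∣≤∣p-q∣+∣q∣ : ∀ p q → ℚ.∣ p ∣ ℚ.≤ ℚ.∣ p ℚ.- q ∣ ℚ.+ ℚ.∣ q ∣
  ∣p∣≤∣p-q∣+∣q∣ p q = subst (λ r → ℚ.∣ r ∣ ℚ.≤ ℚ.∣ p ℚ.- q ∣ ℚ.+ ℚ.∣ q ∣)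
    (minus-plus p q)
    (ℚ.∣p+q∣≤∣p∣+∣q∣ (p ℚ.- q) q)

  ≤+⇒-≤ : ∀ {p q r} → p ℚ.≤ r ℚ.+ q → p ℚ.- q ℚ.≤ r
  ≤+⇒-≤ {p} {q} {r} h = subst (p ℚ.- q ℚ.≤_)
    (plus-minus r q)
    (ℚ.+-monoˡ-≤ (ℚ.- q) h)

  ∣∣p∣-∣q∣∣≤∣p-q∣ : ∀ p q → ℚ.∣ ℚ.∣ p ∣ ℚ.- ℚ.∣ q ∣ ∣ ℚ.≤ ℚ.∣ p ℚ.- q ∣
  ∣∣p∣-∣q∣∣≤∣p-q∣ p q with ℚ.∣p∣≡p∨∣p∣≡-p (ℚ.∣ p ∣ ℚ.- ℚ.∣ q ∣)
  ... | inj₁ e = subst (ℚ._≤ ℚ.∣ p ℚ.- q ∣) (sym e) (≤+⇒-≤ {q = ℚ.∣ q ∣} (∣p∣≤∣p-q∣+∣q∣ p q))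
  ... | inj₂ e = subst₂ ℚ._≤_
    (trans (sym (neg-minus ℚ.∣ p ∣ ℚ.∣ q ∣)) (sym e))
    (∣-∣-swap q p) (≤+⇒-≤ {q = ℚ.∣ p ∣} (∣p∣≤∣p-q∣+∣q∣ q p))

  *-pos : ∀ {p q} → 0ℚ ℚ.< p → 0ℚ ℚ.< q → 0ℚ ℚ.< p ℚ.* q
  *-pos {p} {q} hp hq = ℚ.positive⁻¹ (p ℚ.* q)
    {{ℚ.pos*pos⇒pos p {{ℚ.positive hp}} q {{ℚ.positive hq}}}}

  Bounded : (ℕ → ℚ) → Set
  Bounded s = ∃ λ K → 0ℚ ℚ.< K × Eventually λ n → ℚ.∣ s n ∣ ℚ.≤ K

  closeTail⇒bounded : ∀ s → CloseTail s 1ℚ → Bounded s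
  closeTail⇒bounded s (N , h) = 1ℚ ℚ.+ ℚ.∣ s N ∣
    , ℚ.+-mono-<-≤ (ℚ.positive⁻¹ 1ℚ) (ℚ.0≤∣p∣ (s N))
    , N , λ n N≤n → ℚ.≤-trans (∣p∣≤∣p-q∣+∣q∣ (s n) (s N))
        (ℚ.+-monoˡ-≤ ℚ.∣ s N ∣ (ℚ.<⇒≤ (h n N N≤n ℕ.≤-refl)))

  bound : ∀ s → Cauchy s → Bounded s
  bound s c = closeTail⇒bounded s (c 1ℚ (ℚ.positive⁻¹ 1ℚ))

  *-bound : ∀ {p q K δ} → 0ℚ ℚ.< K → ℚ.∣ p ∣ ℚ.≤ K → ℚ.∣ q ∣ ℚ.< δ →
            ℚ.∣ p ℚ.* q ∣ ℚ.< K ℚ.* δ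
  *-bound {p} {q} {K} {δ} hK hp hq = subst (ℚ._< K ℚ.* δ) (sym (ℚ.∣p*q∣≡∣p∣*∣q∣ p q))
    (ℚ.≤-<-trans
      (ℚ.*-monoʳ-≤-nonNeg ℚ.∣ q ∣ {{ℚ.∣-∣-nonNeg q}} hp)
      (ℚ.*-monoʳ-<-pos K {{ℚ.positive hK}} hq))

  inverse : ∀ S .{{_ : ℚ.Positive S}} → ∃ λ r → 0ℚ ℚ.< r × S ℚ.* r ≡ 1ℚ
  inverse S = (ℚ.1/ S) {{ℚ.pos⇒nonZero S}}
    , ℚ.positive⁻¹ ((ℚ.1/ S) {{ℚ.pos⇒nonZero S}}) {{ℚ.1/pos⇒pos S}}
    , ℚ.*-inverseʳ S {{ℚ.pos⇒nonZero S}}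

  Split : ℚ → ℚ → ℚ → Set
  Split K L ε = ∃ λ δ → 0ℚ ℚ.< δ × K ℚ.* δ ℚ.+ L ℚ.* δ ≡ ε

  split′ : ∀ K L ε → 0ℚ ℚ.< ε →
           (∃ λ r → 0ℚ ℚ.< r × (K ℚ.+ L) ℚ.* r ≡ 1ℚ) → Split K L ε
  split′ K L ε ε>0 (r , r>0 , eq) = r ℚ.* ε , *-pos r>0 ε>0
    , trans (sym (ℚ.*-distribʳ-+ (r ℚ.* ε) K L))
        (trans (sym (ℚ.*-assoc (K ℚ.+ L) r ε))
          (trans (cong (ℚ._* ε) eq) (ℚ.*-identityˡ ε)))

  split : ∀ K L ε → 0ℚ ℚ.< K → 0ℚ ℚ.< L → 0ℚ ℚ.< ε → Split K L ε
  split K L ε K>0 L>0 ε>0 = split′ K L ε ε>0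
    (inverse (K ℚ.+ L) {{ℚ.positive (ℚ.+-mono-< K>0 L>0)}})

  *-close : ∀ K L δ ε a b c d → 0ℚ ℚ.< K → 0ℚ ℚ.< L →
            K ℚ.* δ ℚ.+ L ℚ.* δ ≡ ε →
            ℚ.∣ a ∣ ℚ.≤ K → ℚ.∣ d ∣ ℚ.≤ L →
            ℚ.∣ a ℚ.- c ∣ ℚ.< δ → ℚ.∣ b ℚ.- d ∣ ℚ.< δ →
            ℚ.∣ a ℚ.* b ℚ.- c ℚ.* d ∣ ℚ.< ε
  *-close K L δ ε a b c d K>0 L>0 Kδ+Lδ≡ε a≤K d≤L a-c b-d = subst₂ ℚ._<_
    (cong ℚ.∣_∣ (times-diff a b c d))
    Kδ+Lδ≡ε
    (ℚ.≤-<-trans (ℚ.∣p+q∣≤∣p∣+∣q∣ (a ℚ.* (b ℚ.- d)) (d ℚ.* (a ℚ.- c)))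
      (ℚ.+-mono-< (*-bound K>0 a≤K b-d) (*-bound L>0 d≤L a-c)))

  abstract
    const-cauchy : ∀ q → Cauchy (λ _ → q)
    const-cauchy q ε p = 0 , λ _ _ _ _ → ∣p-p∣<ε q p

  +-closeTail : ∀ s t ε → CloseTail s (½ ℚ.* ε) → CloseTail t (½ ℚ.* ε) →
                CloseTail (λ n → s n ℚ.+ t n) ε
  +-closeTail s t ε (N , h) (M , k) = N ℕ.⊔ M , λ m n l l′ →
    subst (λ q → ℚ.∣ q ∣ ℚ.< ε) (sym (plus-diff (s m) (t m) (s n) (t n)))
      (∣+∣< (s m ℚ.- s n) (t m ℚ.- t n) ε
        (h m n (ℕ.m⊔n≤o⇒m≤o N M l) (ℕ.m⊔n≤o⇒m≤o N M l′))
        (k m n (ℕ.m⊔n≤o⇒n≤o N M l) (ℕ.m⊔n≤o⇒n≤o N M l′)))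

  abstract
    +-cauchy : ∀ s t → Cauchy s → Cauchy t → Cauchy (λ n → s n ℚ.+ t n)
    +-cauchy s t cs ct ε p = +-closeTail s t ε
      (cs (½ ℚ.* ε) (half-pos ε p)) (ct (½ ℚ.* ε) (half-pos ε p))

  neg-closeTail : ∀ s ε → CloseTail s ε → CloseTail (λ n → ℚ.- s n) ε
  neg-closeTail s ε (N , h) = N , λ m n l l′ →
    subst (λ q → ℚ.∣ q ∣ ℚ.< ε) (neg-diff (s m) (s n)) (h n m l′ l)

  abstract
    neg-cauchy : ∀ s → Cauchy s → Cauchy (λ n → ℚ.- s n)
    neg-cauchy s cs ε p = neg-closeTail s ε (cs ε p)

  *-closeTail : ∀ s t K L δ ε → 0ℚ ℚ.< K → 0ℚ ℚ.< L →
                K ℚ.* δ ℚ.+ L ℚ.* δ ≡ ε →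
                Eventually (λ n → ℚ.∣ s n ∣ ℚ.≤ K) →
                Eventually (λ n → ℚ.∣ t n ∣ ℚ.≤ L) →
                CloseTail s δ → CloseTail t δ →
                CloseTail (λ n → s n ℚ.* t n) ε
  *-closeTail s t K L δ ε K>0 L>0 eq (N , bs) (M , bt) (N′ , h) (M′ , k) =
    (N ℕ.⊔ M) ℕ.⊔ (N′ ℕ.⊔ M′) , λ m n l l′ →
      *-close K L δ ε (s m) (t m) (s n) (t n) K>0 L>0 eq
        (bs m (ℕ.m⊔n≤o⇒m≤o N M (b l)))
        (bt n (ℕ.m⊔n≤o⇒n≤o N M (b l′)))
        (h m n (ℕ.m⊔n≤o⇒m≤o N′ M′ (c l)) (ℕ.m⊔n≤o⇒m≤o N′ M′ (c l′)))
        (k m n (ℕ.m⊔n≤o⇒n≤o N′ M′ (c l)) (ℕ.m⊔n≤o⇒n≤o N′ M′ (c l′)))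
    where
    b : ∀ {i} → (N ℕ.⊔ M) ℕ.⊔ (N′ ℕ.⊔ M′) ℕ.≤ i → N ℕ.⊔ M ℕ.≤ i
    b = ℕ.m⊔n≤o⇒m≤o (N ℕ.⊔ M) (N′ ℕ.⊔ M′)

    c : ∀ {i} → (N ℕ.⊔ M) ℕ.⊔ (N′ ℕ.⊔ M′) ℕ.≤ i → N′ ℕ.⊔ M′ ℕ.≤ i
    c = ℕ.m⊔n≤o⇒n≤o (N ℕ.⊔ M) (N′ ℕ.⊔ M′)

  *-cauchy′ : ∀ s t ε → 0ℚ ℚ.< ε → Cauchy s → Cauchy t →
              Bounded s → Bounded t → CloseTail (λ n → s n ℚ.* t n) ε
  *-cauchy′ s t ε ε>0 cs ct (K , K>0 , bs) (L , L>0 , bt) =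
    go (split K L ε K>0 L>0 ε>0)
    where
    go : Split K L ε → CloseTail (λ n → s n ℚ.* t n) ε
    go (δ , δ>0 , eq) =
      *-closeTail s t K L δ ε K>0 L>0 eq bs bt (cs δ δ>0) (ct δ δ>0)

  abstract
    *-cauchy : ∀ s t → Cauchy s → Cauchy t → Cauchy (λ n → s n ℚ.* t n)
    *-cauchy s t cs ct ε p = *-cauchy′ s t ε p cs ct (bound s cs) (bound t ct)

  ∣∣-closeTail : ∀ s ε → CloseTail s ε → CloseTail (λ n → ℚ.∣ s n ∣) ε
  ∣∣-closeTail s ε (N , h) = N , λ m n l l′ →
    ℚ.≤-<-trans (∣∣p∣-∣q∣∣≤∣p-q∣ (s m) (s n)) (h m n l l′)

  abstract
    ∣∣-cauchy : ∀ s → Cauchy s → Cauchy (λ n → ℚ.∣ s n ∣)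
    ∣∣-cauchy s cs ε p = ∣∣-closeTail s ε (cs ε p)

  CloseTo : (s t : ℕ → ℚ) → ℚ → Set
  CloseTo s t ε = Eventually λ n → ℚ.∣ s n ℚ.- t n ∣ ℚ.< ε

  closeTo-sym : ∀ s t ε → CloseTo s t ε → CloseTo t s ε
  closeTo-sym s t ε (N , h) = N , λ n l →
    subst (ℚ._< ε) (∣-∣-swap (s n) (t n)) (h n l)

  closeTo-trans : ∀ s t u ε → CloseTo s t (½ ℚ.* ε) → CloseTo t u (½ ℚ.* ε) →
                  CloseTo s u ε
  closeTo-trans s t u ε (N , h) (M , k) = N ℕ.⊔ M , λ n l →
    subst (λ q → ℚ.∣ q ∣ ℚ.< ε) (sym (telescope (s n) (t n) (u n)))
      (∣+∣< (s n ℚ.- t n) (t n ℚ.- u n) ε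
        (h n (ℕ.m⊔n≤o⇒m≤o N M l)) (k n (ℕ.m⊔n≤o⇒n≤o N M l)))

  abstract
    ≈-refl : ∀ {x} → x ≈ x
    ≈-refl {x} = mk≈ λ ε p → 0 , λ n _ → ∣p-p∣<ε (seq x n) p

    ≈-sym : ∀ {x y} → x ≈ y → y ≈ x
    ≈-sym {x} {y} e = mk≈ λ ε p → closeTo-sym (seq x) (seq y) ε (converge e ε p)

    ≈-trans : ∀ {x y z} → x ≈ y → y ≈ z → x ≈ z
    ≈-trans {x} {y} {z} e f = mk≈ λ ε p → closeTo-trans (seq x) (seq y) (seq z) ε
      (converge e (½ ℚ.* ε) (half-pos ε p)) (converge f (½ ℚ.* ε) (half-pos ε p))

open RealLemmas
open Identities

≈-isEquivalence : IsEquivalence _≈_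
≈-isEquivalence = record { refl = ≈-refl ; sym = ≈-sym ; trans = ≈-trans }

ℝ-setoid : Setoid 0ℓ 0ℓ
ℝ-setoid = record { isEquivalence = ≈-isEquivalence }

fromℚ : ℚ → ℝ
fromℚ q = mkℝ (λ _ → q) (const-cauchy q)

0ℝ 1ℝ : ℝ
0ℝ = fromℚ 0ℚ
1ℝ = fromℚ 1ℚ

_+_ : ℝ → ℝ → ℝ
x + y = mkℝ (λ n → seq x n ℚ.+ seq y n) (+-cauchy (seq x) (seq y) (cauchy x) (cauchy y))

-_ : ℝ → ℝ
- x = mkℝ (λ n → ℚ.- seq x n) (neg-cauchy (seq x) (cauchy x))

_-_ : ℝ → ℝ → ℝ
x - y = x + - y

_*_ : ℝ → ℝ → ℝ
x * y = mkℝ (λ n → seq x n ℚ.* seq y n) (*-cauchy (seq x) (seq y) (cauchy x) (cauchy y))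

∣_∣ : ℝ → ℝ
∣ x ∣ = mkℝ (λ n → ℚ.∣ seq x n ∣) (∣∣-cauchy (seq x) (cauchy x))

recipℚ : ℚ → ℚ
recipℚ q with q ℚ.≟ 0ℚ
... | yes _  = 0ℚ
... | no q≢0 = (ℚ.1/ q) {{ℚ.≢-nonZero q≢0}}

module RecipLemmas where

  recipℚ-inverse : ∀ q → q ≢ 0ℚ → q ℚ.* recipℚ q ≡ 1ℚ
  recipℚ-inverse q q≢0 with q ℚ.≟ 0ℚ
  ... | yes q≡0 = contradiction q≡0 q≢0
  ... | no  p   = ℚ.*-inverseʳ q {{ℚ.≢-nonZero p}}

  Away : (ℕ → ℚ) → Set
  Away s = ∃ λ c → 0ℚ ℚ.< c × Eventually λ n → c ℚ.≤ ℚ.∣ s n ∣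

  away : (x : ℝ) → x # 0ℝ → Away (seq x)
  away x (inj₁ (mk< c c>0 (N , h))) = c , c>0 , N , λ n l →
    let c≤-x : c ℚ.≤ ℚ.- seq x n
        c≤-x = subst₂ ℚ._≤_
          (plus-minusˡ (seq x n) c)
          (ℚ.+-identityˡ (ℚ.- seq x n))
          (ℚ.+-monoˡ-≤ (ℚ.- seq x n) (h n l))
    in subst (c ℚ.≤_)
         (trans (sym (ℚ.0≤p⇒∣p∣≡p (ℚ.≤-trans (ℚ.<⇒≤ c>0) c≤-x)))
                (ℚ.∣-p∣≡∣p∣ (seq x n)))
         c≤-x
  away x (inj₂ (mk< c c>0 (N , h))) = c , c>0 , N , λ n l →
    let c≤x : c ℚ.≤ seq x n
        c≤x = subst (ℚ._≤ seq x n) (ℚ.+-identityˡ c) (h n l)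
    in subst (c ℚ.≤_) (sym (ℚ.0≤p⇒∣p∣≡p (ℚ.≤-trans (ℚ.<⇒≤ c>0) c≤x))) c≤x

  ≤∣∣⇒≢0 : ∀ {c p} → 0ℚ ℚ.< c → c ℚ.≤ ℚ.∣ p ∣ → p ≢ 0ℚ
  ≤∣∣⇒≢0 c>0 c≤ refl = ℚ.<-irrefl refl (ℚ.<-≤-trans c>0 c≤)

  recip-close : ∀ c ε p q → 0ℚ ℚ.< c → 0ℚ ℚ.< ε →
                c ℚ.≤ ℚ.∣ p ∣ → c ℚ.≤ ℚ.∣ q ∣ →
                ℚ.∣ q ℚ.- p ∣ ℚ.< ε ℚ.* (c ℚ.* c) →
                ℚ.∣ recipℚ p ℚ.- recipℚ q ∣ ℚ.< ε
  recip-close c ε p q c>0 ε>0 cp cq close =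
    ℚ.*-cancelʳ-<-nonNeg ℚ.∣ p ℚ.* q ∣ {{ℚ.∣-∣-nonNeg (p ℚ.* q)}}
      (subst (ℚ._< ε ℚ.* ℚ.∣ p ℚ.* q ∣) lhs (ℚ.<-≤-trans close rhs))
    where
    lhs : ℚ.∣ q ℚ.- p ∣ ≡ ℚ.∣ recipℚ p ℚ.- recipℚ q ∣ ℚ.* ℚ.∣ p ℚ.* q ∣
    lhs = trans
      (cong ℚ.∣_∣ (trans
        (cong₂ ℚ._-_
          (trans (sym (ℚ.*-identityʳ q))
                 (cong (q ℚ.*_) (sym (recipℚ-inverse p (≤∣∣⇒≢0 c>0 cp)))))
          (trans (sym (ℚ.*-identityʳ p))
                 (cong (p ℚ.*_) (sym (recipℚ-inverse q (≤∣∣⇒≢0 c>0 cq))))))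
        (recip-diff p q (recipℚ p) (recipℚ q))))
      (ℚ.∣p*q∣≡∣p∣*∣q∣ (recipℚ p ℚ.- recipℚ q) (p ℚ.* q))

    rhs : ε ℚ.* (c ℚ.* c) ℚ.≤ ε ℚ.* ℚ.∣ p ℚ.* q ∣
    rhs = ℚ.*-monoˡ-≤-nonNeg ε {{ℚ.nonNegative (ℚ.<⇒≤ ε>0)}}
      (subst (c ℚ.* c ℚ.≤_) (sym (ℚ.∣p*q∣≡∣p∣*∣q∣ p q))
        (ℚ.≤-trans
          (ℚ.*-monoˡ-≤-nonNeg c {{ℚ.nonNegative (ℚ.<⇒≤ c>0)}} cq)
          (ℚ.*-monoʳ-≤-nonNeg ℚ.∣ q ∣ {{ℚ.∣-∣-nonNeg q}} cp)))

  recip-closeTail : ∀ s c ε → 0ℚ ℚ.< c → 0ℚ ℚ.< ε →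
                    Eventually (λ n → c ℚ.≤ ℚ.∣ s n ∣) →
                    CloseTail s (ε ℚ.* (c ℚ.* c)) →
                    CloseTail (λ n → recipℚ (s n)) ε
  recip-closeTail s c ε c>0 ε>0 (N , h) (M , k) = N ℕ.⊔ M , λ m n l l′ →
    recip-close c ε (s m) (s n) c>0 ε>0
      (h m (ℕ.m⊔n≤o⇒m≤o N M l)) (h n (ℕ.m⊔n≤o⇒m≤o N M l′))
      (k n m (ℕ.m⊔n≤o⇒n≤o N M l′) (ℕ.m⊔n≤o⇒n≤o N M l))

  recip-cauchy′ : ∀ s → Cauchy s → Away s → Cauchy (λ n → recipℚ (s n))
  recip-cauchy′ s cs (c , c>0 , h) ε p = recip-closeTail s c ε c>0 p h
    (cs (ε ℚ.* (c ℚ.* c)) (*-pos p (*-pos c>0 c>0)))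

  abstract
    recip-cauchy : ∀ x → x # 0ℝ → Cauchy (λ n → recipℚ (seq x n))
    recip-cauchy x x#0 = recip-cauchy′ (seq x) (cauchy x) (away x x#0)

open RecipLemmas

-- recipℚ sends 0 to 0; for x apart from 0 this affects only finitely many terms.
recip : (x : ℝ) → x # 0ℝ → ℝ
recip x x#0 = mkℝ (λ n → recipℚ (seq x n)) (recip-cauchy x x#0)

divide : (x y : ℝ) → y # 0ℝ → ℝ
divide x y y#0 = x * recip y y#0

-- An absent endpoint means that the interval is unbounded on that side.
record OpenInterval : Set where
  constructor ⟨_,_⟩
  field
    lower upper : Maybe ℝ

open OpenInterval public

_∈_ : ℝ → OpenInterval → Set
x ∈ I = All (_< x) (lower I) × All (x <_) (upper I)

⟦_⟧ : OpenInterval → Setoid 0ℓ 0ℓ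
⟦ I ⟧ = On.setoid {B = ∃ (_∈ I)} ℝ-setoid proj₁

Point : OpenInterval → Set
Point I = Setoid.Carrier ⟦ I ⟧

inclusion : (I : OpenInterval) → Func ⟦ I ⟧ ℝ-setoid
inclusion I = record { to = proj₁ ; cong = id }

RealFunction : OpenInterval → Set
RealFunction I = Func ⟦ I ⟧ ℝ-setoid

module _ {I : OpenInterval} where

  differenceQuotient : RealFunction I → (x y : Point I) →
                       (proj₁ y - proj₁ x) # 0ℝ → ℝ
  differenceQuotient h x y =
    divide (Func.to h y - Func.to h x) (proj₁ y - proj₁ x)

  -- h′(x) is the limit of the difference quotients of h at x.  The points y ≠ x
  -- are those with y - x apart from 0, which is what division requires.
  _HasDerivative_ : RealFunction I → RealFunction I → Set
  h HasDerivative h′ =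
    ∀ x ε → 0ℝ < ε → ∃ λ δ → 0ℝ < δ ×
      (∀ y (y#x : (proj₁ y - proj₁ x) # 0ℝ) → ∣ proj₁ y - proj₁ x ∣ < δ →
        ∣ differenceQuotient h x y y#x - Func.to h′ x ∣ < ε)

  record InfinitelyDifferentiable (h : RealFunction I) : Set where
    field
      deriv      : ℕ → RealFunction I
      deriv-zero : ∀ x → Func.to (deriv 0) x ≈ Func.to h x
      deriv-suc  : ∀ n → deriv n HasDerivative deriv (suc n)

  open InfinitelyDifferentiable public

sumℝ : List ℝ → ℝ
sumℝ = List.foldr _+_ 0ℝ

productℝ : ∀ {k} → Vec ℝ k → ℝ
productℝ = Vec.foldr′ _*_ 1ℝ

sumFromTo : ℕ → ℕ → (ℕ → ℝ) → ℝ
sumFromTo m n t = sumℝ (List.map (λ i → t (m ℕ.+ i)) (upTo (suc n ∸ m)))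

-- All (λ₁ , … , λₖ) with λᵢ ≥ 1 and λ₁ + ⋯ + λₖ = n, each listed once.
compositions : (n k : ℕ) → List (Vec ℕ k)
compositions zero    zero    = [] ∷ []
compositions (suc _) zero    = []
compositions n       (suc k) = concatMap
  (λ i → List.map (suc i ∷_) (compositions (n ∸ suc i) k)) (upTo n)

invFactorial : ℕ → ℝ
invFactorial n = fromℚ (((+ 1) ℚ./ (n !)) {{n ℕ.!≢0}})

module _ {I : OpenInterval} {h : RealFunction I} where

  -- The coefficient h⁽ⁿ⁾(x) / n! of zⁿ in h(x + z) - h(x), for n ≥ 1.
  coefficient : InfinitelyDifferentiable h → ℕ → Point I → ℝ
  coefficient H n x = Func.to (deriv H n) x * invFactorial n

  composita : InfinitelyDifferentiable h → (n k : ℕ) → Point I → ℝ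
  composita H n k x = sumℝ (List.map
    (λ parts → productℝ (Vec.map (λ i → coefficient H i x) parts))
    (compositions n k))

_∘_ : {A B C : Setoid 0ℓ 0ℓ} → Func B C → Func A B → Func A C
g ∘ f = function f g

{-# OPTIONS --safe #-}

-- Bounding the remainder h(y) - h(x) - h′(x)(y - x) by o(y - x) makes the sum,
-- product and chain rules free of divisions; since ≤ is stable, the bound also
-- covers points y not known to be apart from x.  Hence differential polynomials
-- in the f⁽ⁱ⁾ and g⁽ʲ⁾ ∘ f are differentiable, and the iterated formal derivatives
-- of g ∘ f are its derivatives, uniquely.  Their Taylor series satisfy
-- T(g⁽ʲ⁾ ∘ f)′ = T(g⁽ʲ⁺¹⁾ ∘ f) · T(f)′, the recursion that determines the composites of
-- formal power series, so T(g ∘ f) is such a composite.  The composita is the array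
-- of coefficients of the powers of a series, and substitution is multiplicative.
module Submission where

open import Algebra using (CommutativeSemiring)
import Algebra.Structures.Biased as Biased
open import Data.Empty using (⊥-elim)
open import Data.Integer as ℤ using (+_)
import Data.Integer.Properties as ℤ
open import Data.List as List using (List; []; _∷_; upTo; applyUpTo; concatMap; _++_)
import Data.List.Properties as List
open import Data.Maybe using (just; nothing)
open import Data.Maybe.Relation.Unary.All using (All; just; nothing)
open import Data.Nat as ℕ using (ℕ; zero; suc; _!; _∸_)
import Data.Nat.Properties as ℕ
open import Data.Product using (∃; _×_; _,_; proj₁)
open import Data.Rational as ℚ using (ℚ; 0ℚ; 1ℚ; ½)
import Data.Rational.Properties as ℚ
open import Data.Rational.Solver using (module +-*-Solver)
open import Data.Rational.Unnormalised as ℚᵘ using (mkℚᵘ; *≡*)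
import Data.Rational.Unnormalised.Properties as ℚᵘ
open import Data.Sum using (inj₁; inj₂)
open import Data.Vec as Vec using (Vec)
open import Function using (Func; id)
open import Relation.Binary.PropositionalEquality as ≡ using (_≡_)
open import Relation.Nullary using (¬_; yes; no)

-- Formal power series

-- The claim speaks of an arbitrary record of derivatives of `g ∘ f`, so one record has to be
-- constructed and every other shown to agree with it. Closure of differential polynomials under `D`
-- supplies all orders at once, without an explicit formula for the n-th derivative. The remainder
-- form answers the chain rule: `f y - f x` need not be apart from 0, so it cannot be divided by.
-- The formal side never subtracts, hence commutative semirings; division by n + 1 becomes a
-- cancellation law, assumed only where derivatives have to determine coefficients. An inner series
-- without constant term is written `shift Φ`, which makes each coefficient of a composite a finite
-- sum.

module PowerSeries {c ℓ} (R : CommutativeSemiring c ℓ) where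
  open CommutativeSemiring R
  open import Algebra.Solver.Ring.NaturalCoefficients.Default R
    using (solve; con; _:=_; _:+_; _:*_)
  open import Relation.Binary.Reasoning.Setoid setoid

  infixl 6 _⊞_
  infixl 7 _⊛_
  infixr 8 _^ˢ_
  infix 4 _≋_

  Series : Set c
  Series = ℕ → Carrier

  _≋_ : Series → Series → Set ℓ
  A ≋ B = ∀ n → A n ≈ B n

  tail : Series → Series
  tail A n = A (suc n)

  shift : Series → Series
  shift A zero    = 0#
  shift A (suc n) = A n

  _⊞_ : Series → Series → Series
  (A ⊞ B) n = A n + B n

  scale : Carrier → Series → Series
  scale a A n = a * A n

  -- The Cauchy product, peeled along `A = A 0 + z · tail A`, so that identities follow by induction
  -- on the degree.
  _⊛_ : Series → Series → Series
  (A ⊛ B) zero    = A 0 * B 0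
  (A ⊛ B) (suc n) = A 0 * B (suc n) + (tail A ⊛ B) n

  one : Series
  one zero    = 1#
  one (suc n) = 0#

  _^ˢ_ : Series → ℕ → Series
  A ^ˢ zero  = one
  A ^ˢ suc k = A ⊛ A ^ˢ k

  -- Degree n of a product sees only degrees up to n of its factors. This is how a bounded induction
  -- hypothesis gets inside a product.
  ⊛-cong-≤ : ∀ A A′ B B′ n → (∀ i → i ℕ.≤ n → A i ≈ A′ i) →
             (∀ i → i ℕ.≤ n → B i ≈ B′ i) → (A ⊛ B) n ≈ (A′ ⊛ B′) n
  ⊛-cong-≤ A A′ B B′ zero    p q = *-cong (p 0 ℕ.z≤n) (q 0 ℕ.z≤n)
  ⊛-cong-≤ A A′ B B′ (suc n) p q = +-cong
    (*-cong (p 0 ℕ.z≤n) (q (suc n) ℕ.≤-refl))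
    (⊛-cong-≤ (tail A) (tail A′) B B′ n
      (λ i l → p (suc i) (ℕ.s≤s l)) (λ i l → q i (ℕ.m≤n⇒m≤1+n l)))

  ⊛-cong : ∀ A A′ B B′ → A ≋ A′ → B ≋ B′ → A ⊛ B ≋ A′ ⊛ B′
  ⊛-cong A A′ B B′ p q n = ⊛-cong-≤ A A′ B B′ n (λ i _ → p i) (λ i _ → q i)

  ⊛-congʳ : ∀ A A′ B → A ≋ A′ → A ⊛ B ≋ A′ ⊛ B
  ⊛-congʳ A A′ B p = ⊛-cong A A′ B B p (λ _ → refl)

  ⊛-congˡ : ∀ A B B′ → B ≋ B′ → A ⊛ B ≋ A ⊛ B′
  ⊛-congˡ A B B′ = ⊛-cong A A B B′ (λ _ → refl)

  ^ˢ-cong : ∀ A B k → A ≋ B → A ^ˢ k ≋ B ^ˢ k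
  ^ˢ-cong A B zero    p n = refl
  ^ˢ-cong A B (suc k) p = ⊛-cong A B (A ^ˢ k) (B ^ˢ k) p (^ˢ-cong A B k p)

  ⊛-distribˡ : ∀ A B C → A ⊛ (B ⊞ C) ≋ A ⊛ B ⊞ A ⊛ C
  ⊛-distribˡ A B C zero    = distribˡ (A 0) (B 0) (C 0)
  ⊛-distribˡ A B C (suc n) = trans
    (+-congˡ (⊛-distribˡ (tail A) B C n))
    (solve 5 (λ a b c x y →
      a :* (b :+ c) :+ (x :+ y) := a :* b :+ x :+ (a :* c :+ y)) refl
      (A 0) (B (suc n)) (C (suc n)) ((tail A ⊛ B) n) ((tail A ⊛ C) n))

  -- The mirror image of the defining recursion, peeling the right factor; commutativity is the
  -- agreement of the two.
  ⊛-sucʳ : ∀ A B n → (A ⊛ B) (suc n) ≈ A (suc n) * B 0 + (A ⊛ tail B) n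
  ⊛-sucʳ A B zero    = +-comm (A 0 * B 1) (A 1 * B 0)
  ⊛-sucʳ A B (suc n) = trans (+-congˡ (⊛-sucʳ (tail A) B n))
    (solve 3 (λ x y z → x :+ (y :+ z) := y :+ (x :+ z)) refl
      (A 0 * B (suc (suc n))) (A (suc (suc n)) * B 0) ((tail A ⊛ tail B) n))

  ⊛-comm : ∀ A B → A ⊛ B ≋ B ⊛ A
  ⊛-comm A B zero    = *-comm (A 0) (B 0)
  ⊛-comm A B (suc n) = trans (⊛-sucʳ A B n)
    (+-cong (*-comm (A (suc n)) (B 0)) (⊛-comm A (tail B) n))

  ⊛-distribʳ : ∀ A B C → (A ⊞ B) ⊛ C ≋ A ⊛ C ⊞ B ⊛ C
  ⊛-distribʳ A B C n = begin
    ((A ⊞ B) ⊛ C) n         ≈⟨ ⊛-comm (A ⊞ B) C n ⟩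
    (C ⊛ (A ⊞ B)) n         ≈⟨ ⊛-distribˡ C A B n ⟩
    (C ⊛ A) n + (C ⊛ B) n   ≈⟨ +-cong (⊛-comm C A n) (⊛-comm C B n) ⟩
    (A ⊛ C) n + (B ⊛ C) n   ∎

  ⊛-scaleʳ : ∀ a A B → A ⊛ scale a B ≋ scale a (A ⊛ B)
  ⊛-scaleʳ a A B zero =
    solve 3 (λ a x y → x :* (a :* y) := a :* (x :* y)) refl a (A 0) (B 0)
  ⊛-scaleʳ a A B (suc n) = trans (+-congˡ (⊛-scaleʳ a (tail A) B n))
    (solve 4 (λ a x y z → x :* (a :* y) :+ a :* z := a :* (x :* y :+ z)) refl
      a (A 0) (B (suc n)) ((tail A ⊛ B) n))

  ⊛-scaleˡ : ∀ a A B → scale a A ⊛ B ≋ scale a (A ⊛ B)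
  ⊛-scaleˡ a A B n = begin
    (scale a A ⊛ B) n   ≈⟨ ⊛-comm (scale a A) B n ⟩
    (B ⊛ scale a A) n   ≈⟨ ⊛-scaleʳ a B A n ⟩
    a * (B ⊛ A) n       ≈⟨ *-congˡ (⊛-comm B A n) ⟩
    a * (A ⊛ B) n       ∎

  ⊛-assoc : ∀ A B C → (A ⊛ B) ⊛ C ≋ A ⊛ (B ⊛ C)
  ⊛-assoc A B C zero    = *-assoc (A 0) (B 0) (C 0)
  ⊛-assoc A B C (suc n) = begin
    A 0 * B 0 * C (suc n) + ((scale (A 0) (tail B) ⊞ tail A ⊛ B) ⊛ C) n
      ≈⟨ +-congˡ (⊛-distribʳ (scale (A 0) (tail B)) (tail A ⊛ B) C n) ⟩
    A 0 * B 0 * C (suc n) + ((scale (A 0) (tail B) ⊛ C) n + ((tail A ⊛ B) ⊛ C) n)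
      ≈⟨ +-congˡ (+-cong (⊛-scaleˡ (A 0) (tail B) C n) (⊛-assoc (tail A) B C n)) ⟩
    A 0 * B 0 * C (suc n) + (A 0 * (tail B ⊛ C) n + (tail A ⊛ (B ⊛ C)) n)
      ≈⟨ solve 5 (λ a b c x y → a :* b :* c :+ (a :* x :+ y) := a :* (b :* c :+ x) :+ y)
           refl (A 0) (B 0) (C (suc n)) ((tail B ⊛ C) n) ((tail A ⊛ (B ⊛ C)) n) ⟩
    A 0 * (B 0 * C (suc n) + (tail B ⊛ C) n) + (tail A ⊛ (B ⊛ C)) n ∎

  ⊛-shiftˡ : ∀ A B → shift A ⊛ B ≋ shift (A ⊛ B)
  ⊛-shiftˡ A B zero    = zeroˡ (B 0)
  ⊛-shiftˡ A B (suc n) = trans (+-congʳ (zeroˡ (B (suc n)))) (+-identityˡ ((A ⊛ B) n))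

  -- Finite sums and substitution of series

  ∑ : ℕ → Series → Carrier
  ∑ zero    t = t 0
  ∑ (suc n) t = t 0 + ∑ n (tail t)

  ∑-cong : ∀ n s t → s ≋ t → ∑ n s ≈ ∑ n t
  ∑-cong zero    s t p = p 0
  ∑-cong (suc n) s t p = +-cong (p 0) (∑-cong n (tail s) (tail t) (λ i → p (suc i)))

  ∑-⊞ : ∀ n s t → ∑ n (s ⊞ t) ≈ ∑ n s + ∑ n t
  ∑-⊞ zero    s t = refl
  ∑-⊞ (suc n) s t = trans (+-congˡ (∑-⊞ n (tail s) (tail t)))
    (solve 4 (λ a b x y → a :+ b :+ (x :+ y) := a :+ x :+ (b :+ y)) refl
      (s 0) (t 0) (∑ n (tail s)) (∑ n (tail t)))

  ∑-scale : ∀ n a t → ∑ n (scale a t) ≈ a * ∑ n t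
  ∑-scale zero    a t = refl
  ∑-scale (suc n) a t = trans (+-congˡ (∑-scale n a (tail t)))
    (sym (distribˡ a (t 0) (∑ n (tail t))))

  ∑-zero : ∀ n t → (∀ i → t i ≈ 0#) → ∑ n t ≈ 0#
  ∑-zero zero    t p = p 0
  ∑-zero (suc n) t p = trans
    (+-cong (p 0) (∑-zero n (tail t) (λ i → p (suc i)))) (+-identityˡ 0#)

  ∑-extend : ∀ {n m} t → n ℕ.≤ m → (∀ i → n ℕ.< i → t i ≈ 0#) → ∑ m t ≈ ∑ n t
  ∑-extend {m = zero}  t ℕ.z≤n p = refl
  ∑-extend {m = suc m} t ℕ.z≤n p = trans
    (+-congˡ (∑-zero m (tail t) (λ i → p (suc i) (ℕ.s≤s ℕ.z≤n)))) (+-identityʳ (t 0))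
  ∑-extend t (ℕ.s≤s l) p =
    +-congˡ (∑-extend (tail t) l (λ i q → p (suc i) (ℕ.s≤s q)))

  ⊛-∑ : ∀ A (s : Series) (B : ℕ → Series) m n →
        (A ⊛ λ i → ∑ m (λ k → s k * B k i)) n ≈ ∑ m (λ k → s k * (A ⊛ B k) n)
  ⊛-∑ A s B zero    n = ⊛-scaleʳ (s 0) A (B 0) n
  ⊛-∑ A s B (suc m) n = trans
    (⊛-distribˡ A (scale (s 0) (B 0)) (λ i → ∑ m (λ k → s (suc k) * B (suc k) i)) n)
    (+-cong (⊛-scaleʳ (s 0) A (B 0) n) (⊛-∑ A (tail s) (λ k → B (suc k)) m n))

  -- Each factor `shift A` contributes one factor z, so the k-th power is divisible by the k-th
  -- power of z.
  ^ˢ-vanish : ∀ A k i → i ℕ.< k → (shift A ^ˢ k) i ≈ 0#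
  ^ˢ-vanish A (suc k) zero    l = zeroˡ ((shift A ^ˢ k) 0)
  ^ˢ-vanish A (suc k) (suc i) (ℕ.s≤s l) = begin
    (shift A ⊛ shift A ^ˢ k) (suc i)   ≈⟨ ⊛-shiftˡ A (shift A ^ˢ k) (suc i) ⟩
    (A ⊛ shift A ^ˢ k) i
      -- Up to degree `i` the remaining power is zero; writing zero as `scale 0# one` lets the
      -- scalar be pulled out of the product.
      ≈⟨ ⊛-cong-≤ A A (shift A ^ˢ k) (scale 0# one) i (λ _ _ → refl)
           (λ j q → trans (^ˢ-vanish A k j (ℕ.≤-<-trans q l)) (sym (zeroˡ (one j)))) ⟩
    (A ⊛ scale 0# one) i               ≈⟨ ⊛-scaleʳ 0# A one i ⟩
    0# * (A ⊛ one) i                   ≈⟨ zeroˡ ((A ⊛ one) i) ⟩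
    0#                                 ∎

  fromℕ : ℕ → Carrier
  fromℕ zero    = 0#
  fromℕ (suc n) = 1# + fromℕ n

  -- The Euler operator z·d/dz.  Unlike d/dz it does not move coefficients, so
  -- that its Leibniz rule follows the recursion of ⊛.
  θ : Series → Series
  θ A n = fromℕ n * A n

  ∂ : Series → Series
  ∂ A = tail (θ A)

  θ-⊛ : ∀ A B → θ (A ⊛ B) ≋ θ A ⊛ B ⊞ A ⊛ θ B
  θ-⊛ A B zero    = solve 2 (λ a b →
    con 0 :* (a :* b) := con 0 :* a :* b :+ a :* (con 0 :* b)) refl (A 0) (B 0)
  θ-⊛ A B (suc n) = begin
    (1# + fromℕ n) * (A 0 * B (suc n) + (tail A ⊛ B) n)
      ≈⟨ solve 4 (λ m a b x → (con 1 :+ m) :* (a :* b :+ x) :=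
           con 0 :* a :* b :+ a :* ((con 1 :+ m) :* b) :+ (x :+ m :* x)) refl
           (fromℕ n) (A 0) (B (suc n)) ((tail A ⊛ B) n) ⟩
    u + v + ((tail A ⊛ B) n + fromℕ n * (tail A ⊛ B) n)
      ≈⟨ +-congˡ (+-congˡ (θ-⊛ (tail A) B n)) ⟩
    u + v + ((tail A ⊛ B) n + ((θ (tail A) ⊛ B) n + (tail A ⊛ θ B) n))
      ≈⟨ solve 5 (λ u v x y z → u :+ v :+ (x :+ (y :+ z)) := u :+ (x :+ y) :+ (v :+ z))
           refl u v ((tail A ⊛ B) n) ((θ (tail A) ⊛ B) n) ((tail A ⊛ θ B) n) ⟩
    u + ((tail A ⊛ B) n + (θ (tail A) ⊛ B) n) + (v + (tail A ⊛ θ B) n)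
      ≈⟨ +-congʳ (+-congˡ (⊛-distribʳ (tail A) (θ (tail A)) B n)) ⟨
    u + ((tail A ⊞ θ (tail A)) ⊛ B) n + (v + (tail A ⊛ θ B) n)
      -- Lowering the index by one lowers the Euler weight by one, so `∂ A` is
      -- `tail A ⊞ θ (tail A)`.
      ≈⟨ +-congʳ (+-congˡ (⊛-congʳ (tail A ⊞ θ (tail A)) (∂ A) B (λ i →
           solve 2 (λ m a → a :+ m :* a := (con 1 :+ m) :* a) refl
             (fromℕ i) (A (suc i))) n)) ⟩
    u + (∂ A ⊛ B) n + (v + (tail A ⊛ θ B) n) ∎
    where
    u v : Carrier
    u = 0# * A 0 * B (suc n)
    v = A 0 * ((1# + fromℕ n) * B (suc n))

  -- The composite G(z·Φ(z)).  Only the terms of degree at most n contribute to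
  -- the coefficient of zⁿ.
  compose : Series → Series → Series
  compose G Φ n = ∑ n (λ k → G k * (shift Φ ^ˢ k) n)

  compose-congˡ : ∀ G H Φ → G ≋ H → compose G Φ ≋ compose H Φ
  compose-congˡ G H Φ p n = ∑-cong n (λ k → G k * (shift Φ ^ˢ k) n)
    (λ k → H k * (shift Φ ^ˢ k) n) (λ k → *-congʳ (p k))

  compose-⊞ : ∀ G H Φ → compose (G ⊞ H) Φ ≋ compose G Φ ⊞ compose H Φ
  compose-⊞ G H Φ n = trans
    (∑-cong n (λ k → (G k + H k) * (shift Φ ^ˢ k) n) (s ⊞ t)
      (λ k → distribʳ ((shift Φ ^ˢ k) n) (G k) (H k)))
    (∑-⊞ n s t)
    where
    s t : Series
    s k = G k * (shift Φ ^ˢ k) n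
    t k = H k * (shift Φ ^ˢ k) n

  compose-scale : ∀ a G Φ → compose (scale a G) Φ ≋ scale a (compose G Φ)
  compose-scale a G Φ n = trans
    (∑-cong n (λ k → a * G k * (shift Φ ^ˢ k) n) (scale a (λ k → G k * (shift Φ ^ˢ k) n))
      (λ k → *-assoc a (G k) ((shift Φ ^ˢ k) n)))
    (∑-scale n a (λ k → G k * (shift Φ ^ˢ k) n))

  -- Horner's rule: substituting z · Φ into `G = G 0 + z · tail G` leaves `G 0` plus z · Φ times the
  -- composite of `tail G`. The inductions on the degree of a composite rest on it.
  compose-suc : ∀ G Φ n → compose G Φ (suc n) ≈ (Φ ⊛ compose (tail G) Φ) n
  compose-suc G Φ n = begin
    G 0 * 0# + ∑ n (λ k → G (suc k) * (shift Φ ^ˢ suc k) (suc n))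
      ≈⟨ trans (+-congʳ (zeroʳ (G 0))) (+-identityˡ _) ⟩
    ∑ n (λ k → G (suc k) * (shift Φ ^ˢ suc k) (suc n))
      ≈⟨ ∑-cong n _ (λ k → G (suc k) * (Φ ⊛ shift Φ ^ˢ k) n)
           (λ k → *-congˡ (⊛-shiftˡ Φ (shift Φ ^ˢ k) (suc n))) ⟩
    ∑ n (λ k → G (suc k) * (Φ ⊛ shift Φ ^ˢ k) n)
      ≈⟨ ⊛-∑ Φ (tail G) (shift Φ ^ˢ_) n n ⟨
    (Φ ⊛ λ i → ∑ n (λ k → G (suc k) * (shift Φ ^ˢ k) i)) n
      -- The inner sum has the fixed bound `n`, whereas `compose` stops at `i`; the terms in between
      -- vanish by divisibility.
      ≈⟨ ⊛-cong-≤ Φ Φ (λ i → ∑ n (λ k → G (suc k) * (shift Φ ^ˢ k) i))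
           (compose (tail G) Φ) n (λ _ _ → refl) (λ i l →
           ∑-extend (λ k → G (suc k) * (shift Φ ^ˢ k) i) l (λ k q →
             trans (*-congˡ (^ˢ-vanish Φ k i q)) (zeroʳ (G (suc k))))) ⟩
    (Φ ⊛ compose (tail G) Φ) n ∎

  -- Strong induction on the degree, made structural by the bound `n`: the hypothesis is used under
  -- a product with `Φ`, for `tail G` and at all degrees up to `j`.
  compose-⊛-≤ : ∀ Φ n G H i → i ℕ.≤ n →
                compose (G ⊛ H) Φ i ≈ (compose G Φ ⊛ compose H Φ) i
  compose-⊛-≤ Φ n G H zero l =
    solve 2 (λ a b → a :* b :* con 1 := a :* con 1 :* (b :* con 1)) refl (G 0) (H 0)
  compose-⊛-≤ Φ (suc n) G H (suc j) (ℕ.s≤s l) = begin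
    compose (G ⊛ H) Φ (suc j)
      ≈⟨ compose-suc (G ⊛ H) Φ j ⟩
    (Φ ⊛ compose (scale (G 0) (tail H) ⊞ tail G ⊛ H) Φ) j
      ≈⟨ ⊛-cong-≤ Φ Φ (compose (scale (G 0) (tail H) ⊞ tail G ⊛ H) Φ)
           (scale (G 0) H′ ⊞ G′ ⊛ compose H Φ) j (λ _ _ → refl) (λ i q → trans
             (compose-⊞ (scale (G 0) (tail H)) (tail G ⊛ H) Φ i)
             (+-cong (compose-scale (G 0) (tail H) Φ i)
               (compose-⊛-≤ Φ n (tail G) H i (ℕ.≤-trans q l)))) ⟩
    (Φ ⊛ (scale (G 0) H′ ⊞ G′ ⊛ compose H Φ)) j
      ≈⟨ ⊛-distribˡ Φ (scale (G 0) H′) (G′ ⊛ compose H Φ) j ⟩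
    (Φ ⊛ scale (G 0) H′) j + (Φ ⊛ (G′ ⊛ compose H Φ)) j
      ≈⟨ +-cong (⊛-scaleʳ (G 0) Φ H′ j) (sym (⊛-assoc Φ G′ (compose H Φ) j)) ⟩
    G 0 * (Φ ⊛ H′) j + ((Φ ⊛ G′) ⊛ compose H Φ) j
      ≈⟨ +-cong (*-cong (*-identityʳ (G 0)) (compose-suc H Φ j))
           (⊛-congʳ (tail (compose G Φ)) (Φ ⊛ G′) (compose H Φ) (compose-suc G Φ) j) ⟨
    G 0 * 1# * compose H Φ (suc j) + (tail (compose G Φ) ⊛ compose H Φ) j ∎
    where
    G′ H′ : Series
    G′ = compose (tail G) Φ
    H′ = compose (tail H) Φ

  compose-⊛ : ∀ G H Φ → compose (G ⊛ H) Φ ≋ compose G Φ ⊛ compose H Φ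
  compose-⊛ G H Φ n = compose-⊛-≤ Φ n G H n ℕ.≤-refl

  compose-one : ∀ Φ → compose one Φ ≋ one
  compose-one Φ zero    = *-identityˡ 1#
  compose-one Φ (suc n) = trans
    (+-cong (zeroʳ 1#) (∑-zero n (λ k → 0# * (shift Φ ^ˢ suc k) (suc n))
      (λ k → zeroˡ ((shift Φ ^ˢ suc k) (suc n)))))
    (+-identityˡ 0#)

  compose-^ˢ : ∀ G Φ m → compose (G ^ˢ m) Φ ≋ compose G Φ ^ˢ m
  compose-^ˢ G Φ zero    = compose-one Φ
  compose-^ˢ G Φ (suc m) n = trans (compose-⊛ G (G ^ˢ m) Φ n)
    (⊛-congˡ (compose G Φ) (compose (G ^ˢ m) Φ) (compose G Φ ^ˢ m) (compose-^ˢ G Φ m) n)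

  -- The product rule for `G = G 0 + z · tail G` gives `∂ G` as `tail G` plus z · `∂ (tail G)`;
  -- these are the two terms that the Leibniz rule leaves in the chain rule below.
  compose-∂ : ∀ G Φ → compose (∂ G) Φ ≋
              compose (tail G) Φ ⊞ shift Φ ⊛ compose (∂ (tail G)) Φ
  compose-∂ G Φ zero    = solve 2 (λ a b →
    (con 1 :+ con 0) :* a :* con 1 := a :* con 1 :+ con 0 :* b)
    refl (G 1) (compose (∂ (tail G)) Φ 0)
  compose-∂ G Φ (suc n) = begin
    compose (∂ G) Φ (suc n)
      ≈⟨ compose-suc (∂ G) Φ n ⟩
    (Φ ⊛ compose (tail (∂ G)) Φ) n
      ≈⟨ ⊛-congˡ Φ (compose (tail (∂ G)) Φ) (G″ ⊞ K) (λ i → trans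
           (compose-congˡ (tail (∂ G)) (tail (tail G) ⊞ ∂ (tail G)) Φ (λ k →
             solve 2 (λ m a → (con 1 :+ m) :* a := a :+ m :* a) refl
               (fromℕ (suc k)) (G (suc (suc k)))) i)
           (compose-⊞ (tail (tail G)) (∂ (tail G)) Φ i)) n ⟩
    (Φ ⊛ (G″ ⊞ K)) n
      ≈⟨ ⊛-distribˡ Φ G″ K n ⟩
    (Φ ⊛ G″) n + (Φ ⊛ K) n
      ≈⟨ +-cong (compose-suc (tail G) Φ n) (⊛-shiftˡ Φ K (suc n)) ⟨
    compose (tail G) Φ (suc n) + (shift Φ ⊛ K) (suc n) ∎
    where
    G″ K : Series
    G″ = compose (tail (tail G)) Φ
    K = compose (∂ (tail G)) Φ

  -- The chain rule for series, in Euler form: Horner's rule, then Leibniz, then the hypothesis for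
  -- `tail G`.
  θ-compose-≤ : ∀ Φ n G i → i ℕ.≤ n →
                θ (compose G Φ) i ≈ (θ (shift Φ) ⊛ compose (∂ G) Φ) i
  θ-compose-≤ Φ n G zero l = solve 2 (λ a b → con 0 :* a := con 0 :* con 0 :* b)
    refl (compose G Φ 0) (compose (∂ G) Φ 0)
  θ-compose-≤ Φ (suc n) G (suc j) (ℕ.s≤s l) = begin
    θ (compose G Φ) (suc j)
      ≈⟨ *-congˡ (trans (compose-suc G Φ j) (sym (⊛-shiftˡ Φ G′ (suc j)))) ⟩
    θ (F ⊛ G′) (suc j)
      ≈⟨ θ-⊛ F G′ (suc j) ⟩
    (θ F ⊛ G′) (suc j) + (F ⊛ θ G′) (suc j)
      -- The factor z in `F` lowers the degree to `j`, where the induction hypothesis applies.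
      ≈⟨ +-congˡ (⊛-shiftˡ Φ (θ G′) (suc j)) ⟩
    (θ F ⊛ G′) (suc j) + (Φ ⊛ θ G′) j
      ≈⟨ +-congˡ (⊛-cong-≤ Φ Φ (θ G′) (θ F ⊛ K) j (λ _ _ → refl)
           (λ i q → θ-compose-≤ Φ n (tail G) i (ℕ.≤-trans q l))) ⟩
    (θ F ⊛ G′) (suc j) + (Φ ⊛ (θ F ⊛ K)) j
      ≈⟨ +-congˡ (⊛-shiftˡ Φ (θ F ⊛ K) (suc j)) ⟨
    (θ F ⊛ G′) (suc j) + (F ⊛ (θ F ⊛ K)) (suc j)
      ≈⟨ +-congˡ (⊛-assoc F (θ F) K (suc j)) ⟨
    (θ F ⊛ G′) (suc j) + ((F ⊛ θ F) ⊛ K) (suc j)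
      ≈⟨ +-congˡ (⊛-congʳ (F ⊛ θ F) (θ F ⊛ F) K (⊛-comm F (θ F)) (suc j)) ⟩
    (θ F ⊛ G′) (suc j) + ((θ F ⊛ F) ⊛ K) (suc j)
      ≈⟨ +-congˡ (⊛-assoc (θ F) F K (suc j)) ⟩
    (θ F ⊛ G′) (suc j) + (θ F ⊛ (F ⊛ K)) (suc j)
      ≈⟨ ⊛-distribˡ (θ F) G′ (F ⊛ K) (suc j) ⟨
    (θ F ⊛ (G′ ⊞ F ⊛ K)) (suc j)
      ≈⟨ ⊛-congˡ (θ F) (compose (∂ G) Φ) (G′ ⊞ F ⊛ K) (compose-∂ G Φ) (suc j) ⟨
    (θ F ⊛ compose (∂ G) Φ) (suc j) ∎
    where
    F G′ K : Series
    F = shift Φ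
    G′ = compose (tail G) Φ
    K = compose (∂ (tail G)) Φ

  θ-compose : ∀ G Φ → θ (compose G Φ) ≋ θ (shift Φ) ⊛ compose (∂ G) Φ
  θ-compose G Φ n = θ-compose-≤ Φ n G n ℕ.≤-refl

-- Differential polynomials: inner i stands for f⁽ⁱ⁾ and outer j for g⁽ʲ⁾ ∘ f.
infixl 6 _⊕_
infixl 7 _⊗_

data DiffPoly : Set where
  outer inner : ℕ → DiffPoly
  _⊕_ _⊗_     : DiffPoly → DiffPoly → DiffPoly

D : DiffPoly → DiffPoly
D (outer j) = outer (suc j) ⊗ inner 1
D (inner i) = inner (suc i)
D (p ⊕ q)   = D p ⊕ D q
D (p ⊗ q)   = D p ⊗ q ⊕ p ⊗ D q

-- Differentiating before iterating makes `taylor (D p)` the shifted sequence of derivatives of `p`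
-- by definition.
D^ : ℕ → DiffPoly → DiffPoly
D^ zero    p = p
D^ (suc n) p = D^ n (D p)

D^-inner : ∀ n i → D^ n (inner i) ≡ inner (i ℕ.+ n)
D^-inner zero    i = ≡.cong inner (≡.sym (ℕ.+-identityʳ i))
D^-inner (suc n) i =
  ≡.trans (D^-inner n (suc i)) (≡.cong inner (≡.sym (ℕ.+-suc i n)))

-- The weights w n play the role of 1 / n!.
module FaàDiBruno {c ℓ} (R : CommutativeSemiring c ℓ)
  (w g f : ℕ → CommutativeSemiring.Carrier R) where
  open CommutativeSemiring R
  open PowerSeries R
  open import Algebra.Solver.Ring.NaturalCoefficients.Default R
    using (solve; _:=_; _:+_; _:*_)
  open import Relation.Binary.Reasoning.Setoid setoid

  eval : DiffPoly → Carrier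
  eval (outer j) = g j
  eval (inner i) = f i
  eval (p ⊕ q)   = eval p + eval q
  eval (p ⊗ q)   = eval p * eval q

  taylor : DiffPoly → Series
  taylor p n = eval (D^ n p) * w n

  -- The increment of the inner function divided by z, the form that `compose` expects.
  innerTail : Series
  innerTail n = f (suc n) * w (suc n)

  -- The Taylor series of g⁽ʲ⁾ at f(x) in the variable of g, whereas `taylor (outer j)` expands g⁽ʲ⁾
  -- ∘ f in the variable of f.
  outerSeries : ℕ → Series
  outerSeries j k = g (j ℕ.+ k) * w k

  eval-D^-⊕ : ∀ n p q → eval (D^ n (p ⊕ q)) ≈ eval (D^ n p) + eval (D^ n q)
  eval-D^-⊕ zero    p q = refl
  eval-D^-⊕ (suc n) p q = eval-D^-⊕ n (D p) (D q)

  taylor-⊕ : ∀ p q → taylor (p ⊕ q) ≋ taylor p ⊞ taylor q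
  taylor-⊕ p q n = trans (*-congʳ (eval-D^-⊕ n p q))
    (distribʳ (w n) (eval (D^ n p)) (eval (D^ n q)))

  module _ (w-zero : w 0 ≈ 1#)
           (w-suc : ∀ n → fromℕ (suc n) * w (suc n) ≈ w n)
           (cancel : ∀ n x y → fromℕ (suc n) * x ≈ fromℕ (suc n) * y → x ≈ y) where

    ∂-weighted : ∀ a n → fromℕ (suc n) * (a * w (suc n)) ≈ a * w n
    ∂-weighted a n = trans
      (solve 3 (λ m a x → m :* (a :* x) := a :* (m :* x)) refl (fromℕ (suc n)) a (w (suc n)))
      (*-congˡ (w-suc n))

    ∂-taylor : ∀ p → ∂ (taylor p) ≋ taylor (D p)
    ∂-taylor p n = ∂-weighted (eval (D^ n (D p))) n

    -- Leibniz's formula without binomial coefficients: after multiplication by n + 1, degree n + 1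
    -- reduces on both sides to degree n of the products `D p ⊗ q` and `p ⊗ D q`, and `cancel`
    -- removes the factor. The polynomials grow, hence the induction over all `p` and `q`.
    taylor-⊗ : ∀ n p q → taylor (p ⊗ q) n ≈ (taylor p ⊛ taylor q) n
    taylor-⊗ zero    p q = begin
      eval p * eval q * w 0
        ≈⟨ *-congˡ w-zero ⟩
      eval p * eval q * 1#
        ≈⟨ *-identityʳ (eval p * eval q) ⟩
      eval p * eval q
        ≈⟨ *-cong (trans (*-congˡ w-zero) (*-identityʳ (eval p)))
                  (trans (*-congˡ w-zero) (*-identityʳ (eval q))) ⟨
      eval p * w 0 * (eval q * w 0) ∎
    taylor-⊗ (suc n) p q = cancel n _ _ (begin
      fromℕ (suc n) * taylor (p ⊗ q) (suc n)
        ≈⟨ ∂-taylor (p ⊗ q) n ⟩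
      taylor (D p ⊗ q ⊕ p ⊗ D q) n
        ≈⟨ taylor-⊕ (D p ⊗ q) (p ⊗ D q) n ⟩
      taylor (D p ⊗ q) n + taylor (p ⊗ D q) n
        ≈⟨ +-cong (taylor-⊗ n (D p) q) (taylor-⊗ n p (D q)) ⟩
      (taylor (D p) ⊛ taylor q) n + (taylor p ⊛ taylor (D q)) n
        ≈⟨ +-cong (shift-θ p q) (trans (⊛-comm (taylor p) (θ (taylor q)) (suc n))
             (trans (shift-θ q p) (⊛-comm (taylor (D q)) (taylor p) n))) ⟨
      (θ (taylor p) ⊛ taylor q) (suc n) + (taylor p ⊛ θ (taylor q)) (suc n)
        ≈⟨ θ-⊛ (taylor p) (taylor q) (suc n) ⟨
      fromℕ (suc n) * (taylor p ⊛ taylor q) (suc n) ∎)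
      where
      shift-θ : ∀ p q → (θ (taylor p) ⊛ taylor q) (suc n) ≈ (taylor (D p) ⊛ taylor q) n
      shift-θ p q = begin
        0# * taylor p 0 * taylor q (suc n) + (∂ (taylor p) ⊛ taylor q) n
          ≈⟨ +-congʳ (trans (*-congʳ (zeroˡ (taylor p 0))) (zeroˡ (taylor q (suc n)))) ⟩
        0# + (∂ (taylor p) ⊛ taylor q) n
          ≈⟨ +-identityˡ _ ⟩
        (∂ (taylor p) ⊛ taylor q) n
          ≈⟨ ⊛-congʳ (∂ (taylor p)) (taylor (D p)) (taylor q) (∂-taylor p) n ⟩
        (taylor (D p) ⊛ taylor q) n ∎

    -- Both sides solve Pⱼ′ = Pⱼ₊₁ · f′, with the same constant terms.
    taylor-outer-≤ : ∀ n j i → i ℕ.≤ n →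
                     taylor (outer j) i ≈ compose (outerSeries j) innerTail i
    taylor-outer-≤ n j zero l = begin
      g j * w 0               ≡⟨ ≡.cong (λ k → g k * w 0) (ℕ.+-identityʳ j) ⟨
      g (j ℕ.+ 0) * w 0       ≈⟨ *-identityʳ _ ⟨
      g (j ℕ.+ 0) * w 0 * 1#  ∎
    taylor-outer-≤ (suc n) j (suc i) (ℕ.s≤s l) = cancel i _ _ (begin
      fromℕ (suc i) * taylor (outer j) (suc i)
        ≈⟨ ∂-taylor (outer j) i ⟩
      taylor (outer (suc j) ⊗ inner 1) i
        ≈⟨ taylor-⊗ i (outer (suc j)) (inner 1) ⟩
      (taylor (outer (suc j)) ⊛ taylor (inner 1)) i
        ≈⟨ ⊛-comm (taylor (outer (suc j))) (taylor (inner 1)) i ⟩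
      (taylor (inner 1) ⊛ taylor (outer (suc j))) i
        -- The hypothesis is needed at order `suc j` and all degrees up to `i`, which is why `j` is
        -- general and the degree only bounded.
        ≈⟨ ⊛-cong-≤ (taylor (inner 1)) (∂ F)
             (taylor (outer (suc j))) (compose (∂ (outerSeries j)) innerTail) i
             (λ k _ → sym (∂-inner k)) (λ k q → trans
               (taylor-outer-≤ n (suc j) k (ℕ.≤-trans q l))
               (compose-congˡ (outerSeries (suc j)) (∂ (outerSeries j)) innerTail
                 (λ m → sym (∂-outer m)) k)) ⟩
      (∂ F ⊛ C) i
        ≈⟨ +-identityˡ _ ⟨
      0# + (∂ F ⊛ C) i
        ≈⟨ +-congʳ (trans (*-congʳ (zeroˡ 0#)) (zeroˡ (C (suc i)))) ⟨
      (θ F ⊛ C) (suc i)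
        ≈⟨ θ-compose (outerSeries j) innerTail (suc i) ⟨
      fromℕ (suc i) * compose (outerSeries j) innerTail (suc i) ∎)
      where
      F C : Series
      F = shift innerTail
      C = compose (∂ (outerSeries j)) innerTail
      ∂-inner : ∀ k → ∂ F k ≈ taylor (inner 1) k
      ∂-inner k = trans (∂-weighted (f (suc k)) k)
        (reflexive (≡.cong (λ p → eval p * w k) (≡.sym (D^-inner k 1))))
      ∂-outer : ∂ (outerSeries j) ≋ outerSeries (suc j)
      ∂-outer m = trans (∂-weighted (g (j ℕ.+ suc m)) m)
        (reflexive (≡.cong (λ k → g k * w m) (ℕ.+-suc j m)))

    taylor-outer : ∀ j → taylor (outer j) ≋ compose (outerSeries j) innerTail
    taylor-outer j n = taylor-outer-≤ n j n ℕ.≤-refl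

-- The ordered ring of real numbers

open import Defs
open RealLemmas

-- A certificate for linear arithmetic: `q - p` equals `b - a`, so a known inequality and a ring
-- identity suffice.
≤-by : ∀ {p q} a b → a ℚ.≤ b → p ℚ.+ b ≡ q ℚ.+ a → p ℚ.≤ q
≤-by {p} {q} a b a≤b eq = ≡.subst₂ ℚ._≤_
  (solve 2 (λ p a → p :+ a :- a := p) ≡.refl p a)
  (solve 2 (λ q a → q :+ a :- a := q) ≡.refl q a)
  (ℚ.+-monoˡ-≤ (ℚ.- a) (≡.subst (p ℚ.+ a ℚ.≤_) eq (ℚ.+-monoʳ-≤ p a≤b)))
  where open +-*-Solver

half : ℚ → ℚ
half ε = ½ ℚ.* ε

half< : ∀ ε → 0ℚ ℚ.< ε → half ε ℚ.< ε
half< ε ε>0 = ≡.subst₂ ℚ._<_ (ℚ.+-identityʳ (half ε)) (half+half ε)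
  (ℚ.+-monoʳ-< (half ε) (half-pos ε ε>0))

p≤∣p∣ : ∀ p → p ℚ.≤ ℚ.∣ p ∣
p≤∣p∣ p with ℚ.≤-total 0ℚ p
... | inj₁ 0≤p = ℚ.≤-reflexive (≡.sym (ℚ.0≤p⇒∣p∣≡p 0≤p))
... | inj₂ p≤0 = ℚ.≤-trans p≤0 (ℚ.0≤∣p∣ p)

⊓-pos : ∀ {p q} → 0ℚ ℚ.< p → 0ℚ ℚ.< q → 0ℚ ℚ.< p ℚ.⊓ q
⊓-pos {p} {q} p>0 q>0 with ℚ.⊓-sel p q
... | inj₁ e = ≡.subst (0ℚ ℚ.<_) (≡.sym e) p>0
... | inj₂ e = ≡.subst (0ℚ ℚ.<_) (≡.sym e) q>0

inverse-of : ∀ p → 0ℚ ℚ.< p → ∃ λ r → 0ℚ ℚ.< r × p ℚ.* r ≡ 1ℚ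
inverse-of p p>0 = inverse p {{ℚ.positive p>0}}

always : {P : ℕ → Set} → (∀ n → P n) → Eventually P
always h = 0 , λ n _ → h n

both : {P Q S : ℕ → Set} → (∀ n → P n → Q n → S n) →
       Eventually P → Eventually Q → Eventually S
both f (N , p) (M , q) = N ℕ.⊔ M , λ n l →
  f n (p n (ℕ.m⊔n≤o⇒m≤o N M l)) (q n (ℕ.m⊔n≤o⇒n≤o N M l))

eventually-map : {P Q : ℕ → Set} → (∀ n → P n → Q n) → Eventually P → Eventually Q
eventually-map f (N , p) = N , λ n l → f n (p n l)

eventually-const : {P : Set} → Eventually (λ _ → P) → P
eventually-const (N , p) = p N ℕ.≤-refl

eventually-≡⇒≈ : ∀ {x y} → Eventually (λ n → seq x n ≡ seq y n) → x ≈ y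
eventually-≡⇒≈ {x} {y} h = mk≈ λ ε ε>0 → eventually-map
  (λ n e → ≡.subst (λ q → ℚ.∣ q ℚ.- seq y n ∣ ℚ.< ε) (≡.sym e) (∣p-p∣<ε (seq y n) ε>0)) h

pointwise : ∀ {x y} → (∀ n → seq x n ≡ seq y n) → x ≈ y
pointwise h = eventually-≡⇒≈ (always h)

+-cong : ∀ {x y u v} → x ≈ y → u ≈ v → x + u ≈ y + v
+-cong {x} {y} {u} {v} p q = mk≈ λ ε ε>0 → both
  (λ n a b → ≡.subst (λ r → ℚ.∣ r ∣ ℚ.< ε)
    (≡.sym (Identities.plus-diff (seq x n) (seq u n) (seq y n) (seq v n)))
    (∣+∣< (seq x n ℚ.- seq y n) (seq u n ℚ.- seq v n) ε a b))
  (converge p (half ε) (half-pos ε ε>0)) (converge q (half ε) (half-pos ε ε>0))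

neg-cong : ∀ {x y} → x ≈ y → - x ≈ - y
neg-cong {x} {y} p = mk≈ λ ε ε>0 → eventually-map
  (λ n a → ≡.subst (λ r → ℚ.∣ r ∣ ℚ.< ε) (Identities.neg-diff (seq x n) (seq y n))
    (≡.subst (ℚ._< ε) (∣-∣-swap (seq x n) (seq y n)) a))
  (converge p ε ε>0)

minus-cong : ∀ {x y u v} → x ≈ y → u ≈ v → x - u ≈ y - v
minus-cong p q = +-cong p (neg-cong q)

*-cong : ∀ {x y u v} → x ≈ y → u ≈ v → x * u ≈ y * v
*-cong {x} {y} {u} {v} p q = mk≈ λ ε ε>0 →
  let (K , K>0 , x≤K) = bound (seq x) (cauchy x)
      (L , L>0 , v≤L) = bound (seq v) (cauchy v)
      (δ , δ>0 , eq)  = split K L ε K>0 L>0 ε>0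
  in both
    (λ n (a≤K , d≤L) (a-c , b-d) →
      *-close K L δ ε (seq x n) (seq u n) (seq y n) (seq v n) K>0 L>0 eq a≤K d≤L a-c b-d)
    (both (λ _ → _,_) x≤K v≤L) (both (λ _ → _,_) (converge p δ δ>0) (converge q δ δ>0))

∣∣-cong : ∀ {x y} → x ≈ y → ∣ x ∣ ≈ ∣ y ∣
∣∣-cong {x} {y} p = mk≈ λ ε ε>0 → eventually-map
  (λ n → ℚ.≤-<-trans (∣∣p∣-∣q∣∣≤∣p-q∣ (seq x n) (seq y n))) (converge p ε ε>0)

ℝ-semiring : CommutativeSemiring _ _
ℝ-semiring = record
  { Carrier = ℝ ; _≈_ = _≈_ ; _+_ = _+_ ; _*_ = _*_ ; 0# = 0ℝ ; 1# = 1ℝ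
  ; isCommutativeSemiring = Biased.isCommutativeSemiringˡ record
    { +-isCommutativeMonoid = record
      { isMonoid = record
        { isSemigroup = record
          { isMagma = record { isEquivalence = ≈-isEquivalence ; ∙-cong = +-cong }
          ; assoc = λ x y z → pointwise λ n → ℚ.+-assoc (seq x n) (seq y n) (seq z n) }
        ; identity = (λ x → pointwise λ n → ℚ.+-identityˡ (seq x n))
                   , (λ x → pointwise λ n → ℚ.+-identityʳ (seq x n)) }
      ; comm = λ x y → pointwise λ n → ℚ.+-comm (seq x n) (seq y n) }
    ; *-isCommutativeMonoid = record
      { isMonoid = record
        { isSemigroup = record
          { isMagma = record { isEquivalence = ≈-isEquivalence ; ∙-cong = *-cong }
          ; assoc = λ x y z → pointwise λ n → ℚ.*-assoc (seq x n) (seq y n) (seq z n) }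
        ; identity = (λ x → pointwise λ n → ℚ.*-identityˡ (seq x n))
                   , (λ x → pointwise λ n → ℚ.*-identityʳ (seq x n)) }
      ; comm = λ x y → pointwise λ n → ℚ.*-comm (seq x n) (seq y n) }
    ; distribʳ = λ x y z → pointwise λ n → ℚ.*-distribʳ-+ (seq x n) (seq y n) (seq z n)
    ; zeroˡ = λ x → pointwise λ n → ℚ.*-zeroˡ (seq x n) } }

infix 4 _≤_

-- The slack `ε` makes the relation respect `≈`; a termwise comparison would depend on the
-- representatives.
record _≤_ (x y : ℝ) : Set where
  constructor mk≤
  field
    bounded : ∀ ε → 0ℚ ℚ.< ε → Eventually λ n → seq x n ℚ.≤ seq y n ℚ.+ ε

open _≤_

≤-pointwise : ∀ {x y} → (∀ n → seq x n ℚ.≤ seq y n) → x ≤ y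
≤-pointwise {x} {y} h = mk≤ λ ε ε>0 → always λ n → ≡.subst (ℚ._≤ seq y n ℚ.+ ε)
  (ℚ.+-identityʳ (seq x n)) (ℚ.+-mono-≤ (h n) (ℚ.<⇒≤ ε>0))

≈⇒≤ : ∀ {x y} → x ≈ y → x ≤ y
≈⇒≤ {x} {y} p = mk≤ λ ε ε>0 → eventually-map
  (λ n a → ≤-by (seq x n ℚ.- seq y n) ε
    (ℚ.≤-trans (p≤∣p∣ (seq x n ℚ.- seq y n)) (ℚ.<⇒≤ a))
    (solve 3 (λ x y e → x :+ e := y :+ e :+ (x :- y)) ≡.refl (seq x n) (seq y n) ε))
  (converge p ε ε>0)
  where open +-*-Solver

≤-trans : ∀ {x y z} → x ≤ y → y ≤ z → x ≤ z
≤-trans {x} {y} {z} p q = mk≤ λ ε ε>0 → both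
  (λ n a b → ≤-by (seq x n ℚ.+ seq y n) (seq y n ℚ.+ half ε ℚ.+ (seq z n ℚ.+ half ε))
    (ℚ.+-mono-≤ a b)
    (≡.trans
      (solve 4 (λ x y z h → x :+ (y :+ h :+ (z :+ h)) := z :+ (h :+ h) :+ (x :+ y)) ≡.refl
        (seq x n) (seq y n) (seq z n) (half ε))
      (≡.cong (λ e → seq z n ℚ.+ e ℚ.+ (seq x n ℚ.+ seq y n)) (half+half ε))))
  (bounded p (half ε) (half-pos ε ε>0)) (bounded q (half ε) (half-pos ε ε>0))
  where open +-*-Solver

≤-respˡ : ∀ {x y z} → x ≈ y → y ≤ z → x ≤ z
≤-respˡ p = ≤-trans (≈⇒≤ p)

≤-respʳ : ∀ {x y z} → x ≤ y → y ≈ z → x ≤ z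
≤-respʳ p q = ≤-trans p (≈⇒≤ q)

≤-antisym : ∀ {x y} → x ≤ y → y ≤ x → x ≈ y
≤-antisym {x} {y} p q = mk≈ λ ε ε>0 → both
  (λ n a b → ℚ.≤-<-trans (near n (half ε) a b) (half< ε ε>0))
  (bounded p (half ε) (half-pos ε ε>0)) (bounded q (half ε) (half-pos ε ε>0))
  where
  open +-*-Solver
  near : ∀ n ε → seq x n ℚ.≤ seq y n ℚ.+ ε → seq y n ℚ.≤ seq x n ℚ.+ ε →
         ℚ.∣ seq x n ℚ.- seq y n ∣ ℚ.≤ ε
  near n ε a b with ℚ.∣p∣≡p∨∣p∣≡-p (seq x n ℚ.- seq y n)
  ... | inj₁ e = ≡.subst (ℚ._≤ ε) (≡.sym e) (≤-by _ _ a
    (solve 3 (λ x y e → x :- y :+ (y :+ e) := e :+ x) ≡.refl (seq x n) (seq y n) ε))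
  ... | inj₂ e = ≡.subst (ℚ._≤ ε) (≡.sym e) (≤-by _ _ b
    (solve 3 (λ x y e → :- (x :- y) :+ (x :+ e) := e :+ y) ≡.refl (seq x n) (seq y n) ε))

+-mono-≤ : ∀ {x y u v} → x ≤ y → u ≤ v → x + u ≤ y + v
+-mono-≤ {x} {y} {u} {v} p q = mk≤ λ ε ε>0 → both
  (λ n a b → ≡.subst (seq x n ℚ.+ seq u n ℚ.≤_)
    (≡.trans
      (solve 3 (λ y v h → y :+ h :+ (v :+ h) := y :+ v :+ (h :+ h)) ≡.refl
        (seq y n) (seq v n) (half ε))
      (≡.cong (seq y n ℚ.+ seq v n ℚ.+_) (half+half ε)))
    (ℚ.+-mono-≤ a b))
  (bounded p (half ε) (half-pos ε ε>0)) (bounded q (half ε) (half-pos ε ε>0))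
  where open +-*-Solver

-- Termwise nonnegativity is a property of the representing sequence, stronger
-- than 0ℝ ≤ x, but it is all that monotonicity of products needs here.
NonNeg : ℝ → Set
NonNeg x = ∀ n → 0ℚ ℚ.≤ seq x n

∣∣-nonNeg : ∀ x → NonNeg ∣ x ∣
∣∣-nonNeg x n = ℚ.0≤∣p∣ (seq x n)

fromℚ-nonNeg : ∀ {q} → 0ℚ ℚ.< q → NonNeg (fromℚ q)
fromℚ-nonNeg q>0 n = ℚ.<⇒≤ q>0

*-monoˡ-≤ : ∀ {x y} c → NonNeg c → x ≤ y → c * x ≤ c * y
*-monoˡ-≤ {x} {y} c c≥0 p = mk≤ λ ε ε>0 →
  -- Multiplication by `c` enlarges the slack by at most `K`, so the hypothesis is taken with slack
  -- ε / K.
  let (K , K>0 , c≤K) = bound (seq c) (cauchy c)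
      (r , r>0 , Kr≡1) = inverse-of K K>0
      rε>0 = *-pos r>0 ε>0
  in both
    (λ n a b → ℚ.≤-trans
      (ℚ.*-monoˡ-≤-nonNeg (seq c n) {{ℚ.nonNegative (c≥0 n)}} b)
      (≡.subst (ℚ._≤ seq c n ℚ.* seq y n ℚ.+ ε)
        (≡.sym (ℚ.*-distribˡ-+ (seq c n) (seq y n) (r ℚ.* ε)))
        (ℚ.+-monoʳ-≤ (seq c n ℚ.* seq y n)
          (≡.subst (seq c n ℚ.* (r ℚ.* ε) ℚ.≤_)
            (≡.trans (≡.sym (ℚ.*-assoc K r ε))
              (≡.trans (≡.cong (ℚ._* ε) Kr≡1) (ℚ.*-identityˡ ε)))
            (ℚ.*-monoʳ-≤-nonNeg (r ℚ.* ε) {{ℚ.nonNegative (ℚ.<⇒≤ rε>0)}}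
              (ℚ.≤-trans (p≤∣p∣ (seq c n)) a))))))
    c≤K (bounded p (r ℚ.* ε) rε>0)

*-monoʳ-≤ : ∀ {x y} c → NonNeg c → x ≤ y → x * c ≤ y * c
*-monoʳ-≤ {x} {y} c c≥0 p =
  ≤-respˡ (*-comm x c) (≤-respʳ (*-monoˡ-≤ c c≥0 p) (*-comm c y))
  where open CommutativeSemiring ℝ-semiring using (*-comm)

fromℚ-mono : ∀ {p q} → p ℚ.≤ q → fromℚ p ≤ fromℚ q
fromℚ-mono p≤q = ≤-pointwise λ _ → p≤q

<⇒≱ : ∀ {x y} → x < y → ¬ (y ≤ x)
<⇒≱ {x} {y} (mk< g g>0 sep) p = eventually-const (both
  (λ n a b → flip-≤ (half< g g>0)
    (≤-by _ _ (ℚ.+-mono-≤ a b)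
      (solve 4 (λ x y g h → g :+ (y :+ (x :+ h)) := h :+ (x :+ g :+ y)) ≡.refl
        (seq x n) (seq y n) g (half g))))
  sep (bounded p (half g) (half-pos g g>0)))
  where
  open +-*-Solver
  flip-≤ : ∀ {p q} → p ℚ.< q → ¬ (q ℚ.≤ p)
  flip-≤ p<q q≤p = ℚ.<-irrefl ≡.refl (ℚ.<-≤-trans p<q q≤p)

≤-<-trans : ∀ {x y z} → x ≤ y → y < z → x < z
≤-<-trans {x} {y} {z} p (mk< g g>0 sep) = mk< (half g) (half-pos g g>0) (both
  (λ n a b → ≤-by (seq x n ℚ.+ (seq y n ℚ.+ g)) (seq y n ℚ.+ half g ℚ.+ seq z n)
    (ℚ.+-mono-≤ a b)
    (≡.trans
      (solve 4 (λ x y z h → x :+ h :+ (y :+ h :+ z) := z :+ (x :+ (y :+ (h :+ h)))) ≡.refl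
        (seq x n) (seq y n) (seq z n) (half g))
      (≡.cong (λ e → seq z n ℚ.+ (seq x n ℚ.+ (seq y n ℚ.+ e))) (half+half g))))
  (bounded p (half g) (half-pos g g>0)) sep)
  where open +-*-Solver

<-≤-trans : ∀ {x y z} → x < y → y ≤ z → x < z
<-≤-trans {x} {y} {z} (mk< g g>0 sep) p = mk< (half g) (half-pos g g>0) (both
  (λ n a b → ≤-by (seq x n ℚ.+ g ℚ.+ seq y n) (seq y n ℚ.+ (seq z n ℚ.+ half g))
    (ℚ.+-mono-≤ a b)
    (≡.trans
      (solve 4 (λ x y z h → x :+ h :+ (y :+ (z :+ h)) := z :+ (x :+ (h :+ h) :+ y)) ≡.refl
        (seq x n) (seq y n) (seq z n) (half g))
      (≡.cong (λ e → seq z n ℚ.+ (seq x n ℚ.+ e ℚ.+ seq y n)) (half+half g))))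
  sep (bounded p (half g) (half-pos g g>0)))
  where open +-*-Solver

<⇒≤ : ∀ {x y} → x < y → x ≤ y
<⇒≤ {x} {y} (mk< g g>0 sep) = mk≤ λ ε ε>0 → eventually-map
  (λ n a → ℚ.≤-trans
    (≡.subst (ℚ._≤ seq x n ℚ.+ g) (ℚ.+-identityʳ (seq x n))
      (ℚ.+-monoʳ-≤ (seq x n) (ℚ.<⇒≤ g>0)))
    (ℚ.≤-trans a (≡.subst (ℚ._≤ seq y n ℚ.+ ε) (ℚ.+-identityʳ (seq y n))
      (ℚ.+-monoʳ-≤ (seq y n) (ℚ.<⇒≤ ε>0))))) sep

fromℚ-mono-< : ∀ {p q} → p ℚ.< q → fromℚ p < fromℚ q
fromℚ-mono-< {p} {q} p<q = mk< (q ℚ.- p)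
  (≡.subst (ℚ._< q ℚ.- p) (ℚ.+-inverseʳ p) (ℚ.+-monoˡ-< (ℚ.- p) p<q))
  (always λ _ → ℚ.≤-reflexive
    (solve 2 (λ p q → p :+ (q :- p) := q) ≡.refl p q))
  where open +-*-Solver

positive-≥ : ∀ {x} → 0ℝ < x → ∃ λ q → 0ℚ ℚ.< q × fromℚ q ≤ x
positive-≥ {x} (mk< q q>0 sep) = q , q>0 , mk≤ λ ε ε>0 → eventually-map
  (λ n a → ℚ.≤-trans (≡.subst (ℚ._≤ seq x n) (ℚ.+-identityˡ q) a)
    (≡.subst (ℚ._≤ seq x n ℚ.+ ε) (ℚ.+-identityʳ (seq x n))
      (ℚ.+-monoʳ-≤ (seq x n) (ℚ.<⇒≤ ε>0)))) sep

∣∣-bound : ∀ x → ∃ λ K → 0ℚ ℚ.< K × ∣ x ∣ ≤ fromℚ K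
∣∣-bound x = let (K , K>0 , h) = bound (seq x) (cauchy x) in K , K>0 , mk≤ λ ε ε>0 →
  eventually-map (λ n a → ≡.subst (ℚ._≤ K ℚ.+ ε) (ℚ.+-identityʳ ℚ.∣ seq x n ∣)
    (ℚ.+-mono-≤ a (ℚ.<⇒≤ ε>0))) h

-- Constructively, ≤ is the negation of >, which makes it stable: a proof of
-- x ≤ y may use excluded middle.
≮⇒≥ : ∀ {x y} → ¬ (y < x) → x ≤ y
≮⇒≥ {x} {y} y≮x = mk≤ λ ε ε>0 →
  let η = half (half ε)
      η>0 = half-pos (half ε) (half-pos ε ε>0)
  in decide ε (half ε) η η>0 (half+half ε) (half+half (half ε))
       (+-cauchy (seq x) (seq (- y)) (cauchy x) (cauchy (- y)) η η>0)
  where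
  open +-*-Solver
  decide : ∀ ε h η → 0ℚ ℚ.< η → h ℚ.+ h ≡ ε → η ℚ.+ η ≡ h →
           CloseTail (seq (x - y)) η → Eventually λ n → seq x n ℚ.≤ seq y n ℚ.+ ε
  -- One rational comparison decides. Beyond `N` the difference moves by less than ε / 4: starting
  -- at most ε / 2 it stays below ε, and starting above ε / 2 it keeps the gap ε / 4.
  decide ε h η η>0 h+h η+η (N , close) with seq (x - y) N ℚ.≤? h
  ... | yes small = N , λ n l → ≤-by
    (seq (x - y) n ℚ.- seq (x - y) N ℚ.+ seq (x - y) N ℚ.+ 0ℚ)
    (η ℚ.+ h ℚ.+ η)
    (ℚ.+-mono-≤ (ℚ.+-mono-≤ (ℚ.≤-trans (p≤∣p∣ _) (ℚ.<⇒≤ (close n N l ℕ.≤-refl))) small)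
      (ℚ.<⇒≤ η>0))
    (≡.trans
      (solve 5 (λ x y h η z → x :+ (η :+ h :+ η) :=
          y :+ (h :+ (η :+ η)) :+ (x :- y :- z :+ z :+ con 0ℚ)) ≡.refl
        (seq x n) (seq y n) h η (seq (x - y) N))
      (≡.cong (λ e → seq y n ℚ.+ e ℚ.+
          (seq x n ℚ.- seq y n ℚ.- seq (x - y) N ℚ.+ seq (x - y) N ℚ.+ 0ℚ))
        (≡.trans (≡.cong (h ℚ.+_) η+η) h+h)))
  ... | no large = ⊥-elim (y≮x (mk< η η>0 (N , λ n l → ≤-by
    (h ℚ.+ (seq (x - y) N ℚ.- seq (x - y) n)) (seq (x - y) N ℚ.+ η)
    (ℚ.+-mono-≤ (ℚ.<⇒≤ (ℚ.≰⇒> large))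
      (ℚ.≤-trans (p≤∣p∣ _) (ℚ.<⇒≤ (close N n ℕ.≤-refl l))))
    (≡.trans
      (solve 4 (λ x y η z → y :+ η :+ (z :+ η) := x :+ (η :+ η :+ (z :- (x :- y)))) ≡.refl
        (seq x n) (seq y n) η (seq (x - y) N))
      (≡.cong (λ e → seq x n ℚ.+ (e ℚ.+ (seq (x - y) N ℚ.- seq (x - y) n))) η+η)))))

-- Tightness of apartness; it replaces the undecidable distinction between apart and equal points.
¬#⇒≈ : ∀ {x y} → ¬ (x # y) → x ≈ y
¬#⇒≈ h = ≤-antisym (≮⇒≥ λ l → h (inj₂ l)) (≮⇒≥ λ l → h (inj₁ l))

∣∣≤⇒≈0 : ∀ x → (∀ ε → 0ℚ ℚ.< ε → ∣ x ∣ ≤ fromℚ ε) → x ≈ 0ℝ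
∣∣≤⇒≈0 x h = mk≈ λ ε ε>0 → let η = half (half ε); η>0 = half-pos (half ε) (half-pos ε ε>0) in
  eventually-map (λ n a → ℚ.≤-<-trans
    (≡.subst₂ ℚ._≤_ (≡.cong ℚ.∣_∣ (≡.sym (ℚ.+-identityʳ (seq x n))))
      (half+half (half ε)) a)
    (half< ε ε>0))
  (bounded (h η η>0) η η>0)

∣+∣≤ : ∀ x y → ∣ x + y ∣ ≤ ∣ x ∣ + ∣ y ∣
∣+∣≤ x y = ≤-pointwise λ n → ℚ.∣p+q∣≤∣p∣+∣q∣ (seq x n) (seq y n)

∣*∣≈ : ∀ x y → ∣ x * y ∣ ≈ ∣ x ∣ * ∣ y ∣
∣*∣≈ x y = pointwise λ n → ℚ.∣p*q∣≡∣p∣*∣q∣ (seq x n) (seq y n)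

*-recip : ∀ x (x#0 : x # 0ℝ) → x * recip x x#0 ≈ 1ℝ
*-recip x x#0 = eventually-≡⇒≈ (let (c , c>0 , h) = RecipLemmas.away x x#0 in
  eventually-map (λ n c≤ → RecipLemmas.recipℚ-inverse (seq x n)
    (RecipLemmas.≤∣∣⇒≢0 c>0 c≤)) h)

-- Derivatives

⊓ˡ : ∀ {x} p q → x ≤ fromℚ (p ℚ.⊓ q) → x ≤ fromℚ p
⊓ˡ p q l = ≤-trans l (fromℚ-mono (ℚ.p⊓q≤p p q))

⊓ʳ : ∀ {x} p q → x ≤ fromℚ (p ℚ.⊓ q) → x ≤ fromℚ q
⊓ʳ p q l = ≤-trans l (fromℚ-mono (ℚ.p⊓q≤q p q))

∣+∣-bound : ∀ {x y} z p q → ∣ x ∣ ≤ fromℚ p * z → ∣ y ∣ ≤ fromℚ q * z →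
            ∣ x + y ∣ ≤ fromℚ (p ℚ.+ q) * z
∣+∣-bound {x} {y} z p q a b = ≤-trans (∣+∣≤ x y) (≤-respʳ (+-mono-≤ a b)
  (pointwise λ n → ≡.sym (ℚ.*-distribʳ-+ (seq z n) p q)))

absorb : ∀ K r ε x → K ℚ.* r ≡ 1ℚ → K ℚ.* (r ℚ.* ε ℚ.* x) ≡ ε ℚ.* x
absorb K r ε x e = ≡.trans
  (solve 4 (λ K r ε x → K :* (r :* ε :* x) := K :* r :* (ε :* x)) ≡.refl K r ε x)
  (≡.trans (≡.cong (ℚ._* (ε ℚ.* x)) e) (ℚ.*-identityˡ (ε ℚ.* x)))
  where open +-*-Solver

-- The displacement is abstract so that the chain rule can compare those of two intervals; the
-- constants are rational, so that minima and inverses are exact.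
module Asymptotics {A : Set} (d : A → ℝ) where

  LittleO : (A → ℝ) → Set
  LittleO φ = ∀ ε → 0ℚ ℚ.< ε → ∃ λ δ → 0ℚ ℚ.< δ ×
    (∀ y → ∣ d y ∣ ≤ fromℚ δ → ∣ φ y ∣ ≤ fromℚ ε * ∣ d y ∣)

  BigO : (A → ℝ) → Set
  BigO φ = ∃ λ K → 0ℚ ℚ.< K × ∃ λ δ → 0ℚ ℚ.< δ ×
    (∀ y → ∣ d y ∣ ≤ fromℚ δ → ∣ φ y ∣ ≤ fromℚ K * ∣ d y ∣)

  littleO-cong : ∀ {φ ψ} → (∀ y → φ y ≈ ψ y) → LittleO φ → LittleO ψ
  littleO-cong e h ε ε>0 = let (δ , δ>0 , b) = h ε ε>0 in
    δ , δ>0 , λ y l → ≤-respˡ (∣∣-cong (≈-sym (e y))) (b y l)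

  bigO-cong : ∀ {φ ψ} → (∀ y → φ y ≈ ψ y) → BigO φ → BigO ψ
  bigO-cong e (K , K>0 , δ , δ>0 , b) =
    K , K>0 , δ , δ>0 , λ y l → ≤-respˡ (∣∣-cong (≈-sym (e y))) (b y l)

  littleO-+ : ∀ {φ ψ} → LittleO φ → LittleO ψ → LittleO (λ y → φ y + ψ y)
  littleO-+ {φ} {ψ} h k ε ε>0 =
    let (δ , δ>0 , a) = h (half ε) (half-pos ε ε>0)
        (η , η>0 , b) = k (half ε) (half-pos ε ε>0)
    in δ ℚ.⊓ η , ⊓-pos δ>0 η>0 , λ y l → ≡.subst (λ e → ∣ φ y + ψ y ∣ ≤ fromℚ e * ∣ d y ∣)
         (half+half ε)
         (∣+∣-bound ∣ d y ∣ (half ε) (half ε) (a y (⊓ˡ δ η l)) (b y (⊓ʳ δ η l)))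

  bigO-+ : ∀ {φ ψ} → BigO φ → BigO ψ → BigO (λ y → φ y + ψ y)
  bigO-+ (K , K>0 , δ , δ>0 , a) (L , L>0 , η , η>0 , b) =
    K ℚ.+ L , ℚ.+-mono-< K>0 L>0 , δ ℚ.⊓ η , ⊓-pos δ>0 η>0 ,
    λ y l → ∣+∣-bound ∣ d y ∣ K L (a y (⊓ˡ δ η l)) (b y (⊓ʳ δ η l))

  littleO⇒bigO : ∀ {φ} → LittleO φ → BigO φ
  littleO⇒bigO h = 1ℚ , ℚ.positive⁻¹ 1ℚ , h 1ℚ (ℚ.positive⁻¹ 1ℚ)

  bigO-linear : ∀ c → BigO (λ y → c * d y)
  bigO-linear c = let (K , K>0 , c≤K) = ∣∣-bound c in
    K , K>0 , 1ℚ , ℚ.positive⁻¹ 1ℚ , λ y _ →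
    ≤-respˡ (∣*∣≈ c (d y)) (*-monoʳ-≤ ∣ d y ∣ (∣∣-nonNeg (d y)) c≤K)

  littleO-scale : ∀ c {φ} → LittleO φ → LittleO (λ y → c * φ y)
  littleO-scale c {φ} h ε ε>0 =
    let (K , K>0 , c≤K)  = ∣∣-bound c
        (r , r>0 , Kr≡1) = inverse-of K K>0
        (δ , δ>0 , b)    = h (r ℚ.* ε) (*-pos r>0 ε>0)
    in δ , δ>0 , λ y l → ≤-respˡ (∣*∣≈ c (φ y))
      (≤-trans (*-monoʳ-≤ ∣ φ y ∣ (∣∣-nonNeg (φ y)) c≤K)
      (≤-respʳ (*-monoˡ-≤ (fromℚ K) (fromℚ-nonNeg K>0) (b y l))
        (pointwise λ n → absorb K r ε ℚ.∣ seq (d y) n ∣ Kr≡1)))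

  -- The product is at most K · L · ∣d∣², and one factor ∣d∣ is made smaller than ε / (K · L).
  bigO-*-bigO : ∀ {φ ψ} → BigO φ → BigO ψ → LittleO (λ y → φ y * ψ y)
  bigO-*-bigO {φ} {ψ} (K , K>0 , δ , δ>0 , a) (L , L>0 , η , η>0 , b) ε ε>0 =
    let (r , r>0 , eq) = inverse-of (K ℚ.* L) (*-pos K>0 L>0)
        rε>0 = *-pos r>0 ε>0
        μ = δ ℚ.⊓ η
    in μ ℚ.⊓ (r ℚ.* ε) , ⊓-pos (⊓-pos δ>0 η>0) rε>0 , λ y l →
      ≤-respˡ (∣*∣≈ (φ y) (ψ y))
      (≤-trans (*-monoˡ-≤ ∣ φ y ∣ (∣∣-nonNeg (φ y)) (b y (⊓ʳ δ η (⊓ˡ μ (r ℚ.* ε) l))))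
      (≤-trans
        (*-monoʳ-≤ (fromℚ L * ∣ d y ∣)
          (λ n → nonNeg-* (ℚ.<⇒≤ L>0) (ℚ.0≤∣p∣ (seq (d y) n)))
          (≤-trans (a y (⊓ˡ δ η (⊓ˡ μ (r ℚ.* ε) l)))
            (*-monoˡ-≤ (fromℚ K) (fromℚ-nonNeg K>0) (⊓ʳ μ (r ℚ.* ε) l))))
      (≈⇒≤ (pointwise λ n → ≡.trans
        (solve 5 (λ K L r ε x → K :* (r :* ε) :* (L :* x) := K :* L :* (r :* ε :* x))
          ≡.refl K L r ε ℚ.∣ seq (d y) n ∣)
        (absorb (K ℚ.* L) r ε ℚ.∣ seq (d y) n ∣ eq)))))
    where
    open +-*-Solver
    nonNeg-* : ∀ {p q} → 0ℚ ℚ.≤ p → 0ℚ ℚ.≤ q → 0ℚ ℚ.≤ p ℚ.* q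
    nonNeg-* {p} {q} p≥0 q≥0 = ≡.subst (ℚ._≤ p ℚ.* q) (ℚ.*-zeroʳ p)
      (ℚ.*-monoˡ-≤-nonNeg p {{ℚ.nonNegative p≥0}} q≥0)

open Asymptotics

module _ {A B : Set} (d : A → ℝ) (e : B → ℝ) (f : A → B) where

  -- With r = 1 / K, a displacement below r · η is carried to one below η, and the error r · ε
  -- relative to the new displacement is an error ε relative to the old.
  littleO-∘ : ∀ {ψ} → LittleO e ψ → BigO d (λ y → e (f y)) → LittleO d (λ y → ψ (f y))
  littleO-∘ h (K , K>0 , δ , δ>0 , a) ε ε>0 =
    let (r , r>0 , Kr≡1) = inverse-of K K>0
        rε>0 = *-pos r>0 ε>0
        (η , η>0 , b) = h (r ℚ.* ε) rε>0
    in δ ℚ.⊓ (r ℚ.* η) , ⊓-pos δ>0 (*-pos r>0 η>0) , λ y l →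
      let fy = a y (⊓ˡ δ (r ℚ.* η) l) in
      ≤-trans
        (b (f y) (≤-trans fy (≤-respʳ
          (*-monoˡ-≤ (fromℚ K) (fromℚ-nonNeg K>0) (⊓ʳ δ (r ℚ.* η) l))
          (pointwise λ n → ≡.trans (≡.sym (ℚ.*-assoc K r η))
            (≡.trans (≡.cong (ℚ._* η) Kr≡1) (ℚ.*-identityˡ η))))))
        (≤-respʳ (*-monoˡ-≤ (fromℚ (r ℚ.* ε)) (fromℚ-nonNeg rε>0) fy)
          (pointwise λ n → ≡.trans
            (solve 4 (λ K r ε x → r :* ε :* (K :* x) := K :* (r :* ε :* x)) ≡.refl
              K r ε ℚ.∣ seq (d y) n ∣)
            (absorb K r ε ℚ.∣ seq (d y) n ∣ Kr≡1)))
    where open +-*-Solver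

module _ {I : OpenInterval} where

  displacement : Point I → Point I → ℝ
  displacement x y = proj₁ y - proj₁ x

  remainder : RealFunction I → ℝ → Point I → Point I → ℝ
  remainder h c x y = (Func.to h y - Func.to h x) - c * displacement x y

  -- Unlike the limit of difference quotients, this bounds the remainder also at
  -- the points that are not known to be apart from x.
  DerivativeAt : RealFunction I → ℝ → Point I → Set
  DerivativeAt h c x = LittleO (displacement x) (remainder h c x)

  remainder-quotient : ∀ h c x y (y#x : displacement x y # 0ℝ) →
    remainder h c x y ≈ displacement x y * (differenceQuotient h x y y#x - c)
  remainder-quotient h c x y y#x = ≈-trans
    (≈-trans
      (pointwise λ n → solve 3 (λ b c d → b :- c :* d := b :* con 1ℚ :- c :* d) ≡.refl
        (seq b n) (seq c n) (seq d n))
      (minus-cong (*-cong (≈-refl {b}) (≈-sym (*-recip d y#x))) (≈-refl {c * d})))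
    (pointwise λ n → solve 4
      (λ b c d r → b :* (d :* r) :- c :* d := d :* (b :* r :- c)) ≡.refl
      (seq b n) (seq c n) (seq d n) (seq (recip d y#x) n))
    where
    open +-*-Solver
    b d : ℝ
    b = Func.to h y - Func.to h x
    d = displacement x y

  ∣remainder∣-quotient : ∀ h c x y (y#x : displacement x y # 0ℝ) →
    ∣ remainder h c x y ∣ ≈ ∣ displacement x y ∣ * ∣ differenceQuotient h x y y#x - c ∣
  ∣remainder∣-quotient h c x y y#x = ≈-trans
    (∣∣-cong (remainder-quotient h c x y y#x))
    (∣*∣≈ (displacement x y) (differenceQuotient h x y y#x - c))

  remainder-self : ∀ h c x y → displacement x y ≈ 0ℝ → remainder h c x y ≈ 0ℝ
  remainder-self h c x y d≈0 = ≈-trans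
    (minus-cong (minus-cong (Func.cong h y≈x) (≈-refl {Func.to h x})) (*-cong (≈-refl {c}) d≈0))
    (pointwise λ n → solve 2 (λ a c → a :- a :- c :* con 0ℚ := con 0ℚ) ≡.refl
      (seq (Func.to h x) n) (seq c n))
    where
    open +-*-Solver
    y≈x : proj₁ y ≈ proj₁ x
    y≈x = ≈-trans
      (pointwise λ n → solve 2 (λ y x → y := y :- x :+ x) ≡.refl
        (seq (proj₁ y) n) (seq (proj₁ x) n))
      (≈-trans (+-cong d≈0 (≈-refl {proj₁ x}))
        (pointwise λ n → ℚ.+-identityˡ (seq (proj₁ x) n)))

  -- By stability a larger remainder may be assumed. It excludes that `y` is apart from `x`, since
  -- the quotient bound holds there; so `y` equals `x`, where the remainder is zero, a
  -- contradiction.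
  hasDerivative⇒at : ∀ {h h′} → h HasDerivative h′ → ∀ x → DerivativeAt h (Func.to h′ x) x
  hasDerivative⇒at {h} {h′} der x ε ε>0 =
    let (δ , δ>0 , close) = der x (fromℚ ε) (fromℚ-mono-< ε>0)
        (η , η>0 , η≤δ)   = positive-≥ δ>0
    -- Halving turns the `≤` allowed by `LittleO` into the `<` that the limit asks for.
    in half η , half-pos η η>0 , λ y l → ≮⇒≥ λ big →
      let d = displacement x y
          near : ∣ d ∣ < δ
          near = ≤-<-trans l (<-≤-trans (fromℚ-mono-< (half< η η>0)) η≤δ)
          d≈0 : d ≈ 0ℝ
          d≈0 = ¬#⇒≈ λ d#0 → <⇒≱ big (≤-respˡ (∣remainder∣-quotient h c x y d#0)
            (≤-respʳ (*-monoˡ-≤ ∣ d ∣ (∣∣-nonNeg d) (<⇒≤ (close y d#0 near)))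
              (pointwise λ n → ℚ.*-comm (seq ∣ d ∣ n) ε)))
      in <⇒≱ big (≤-respˡ (∣∣-cong (remainder-self h c x y d≈0))
           (≤-pointwise λ n → ≡.subst (ℚ._≤ ε ℚ.* seq ∣ d ∣ n) (ℚ.*-zeroʳ ε)
             (ℚ.*-monoˡ-≤-nonNeg ε {{ℚ.nonNegative (ℚ.<⇒≤ ε>0)}} (ℚ.0≤∣p∣ (seq d n)))))
    where
    c : ℝ
    c = Func.to h′ x

  at⇒hasDerivative : ∀ {h h′} → (∀ x → DerivativeAt h (Func.to h′ x) x) → h HasDerivative h′
  at⇒hasDerivative {h} {h′} at x ε ε>0 =
    let (e , e>0 , e≤ε) = positive-≥ ε>0
        (δ , δ>0 , b)   = at x (half e) (half-pos e e>0)
    in fromℚ δ , fromℚ-mono-< δ>0 , λ y d#0 near →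
      let d = displacement x y
          i = recip d d#0
          q = differenceQuotient h x y d#0 - c
          ∣d∣∣i∣≈1 : ∣ d ∣ * ∣ i ∣ ≈ 1ℝ
          ∣d∣∣i∣≈1 = ≈-trans (≈-sym (∣*∣≈ d i))
            (≈-trans (∣∣-cong (*-recip d d#0)) (pointwise λ _ → ≡.refl))
          open CommutativeSemiring ℝ-semiring using (*-comm; *-assoc; *-identityʳ)
          ∣q∣≈ : ∣ q ∣ ≈ ∣ d ∣ * ∣ q ∣ * ∣ i ∣
          ∣q∣≈ = ≈-trans (≈-sym (*-identityʳ ∣ q ∣))
            (≈-trans (*-cong (≈-refl {∣ q ∣}) (≈-sym ∣d∣∣i∣≈1))
            (≈-trans (≈-sym (*-assoc (∣ q ∣) (∣ d ∣) (∣ i ∣)))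
              (*-cong (*-comm (∣ q ∣) (∣ d ∣)) (≈-refl {∣ i ∣}))))
          bound-q : ∣ q ∣ ≤ fromℚ (half e)
          bound-q = ≤-respˡ ∣q∣≈ (≤-respʳ
            (*-monoʳ-≤ ∣ i ∣ (∣∣-nonNeg i)
              (≤-respˡ (≈-sym (∣remainder∣-quotient h c x y d#0)) (b y (<⇒≤ near))))
            (≈-trans (*-assoc (fromℚ (half e)) (∣ d ∣) (∣ i ∣))
            (≈-trans (*-cong (≈-refl {fromℚ (half e)}) ∣d∣∣i∣≈1)
              (*-identityʳ (fromℚ (half e))))))
      in ≤-<-trans bound-q (<-≤-trans (fromℚ-mono-< (half< e e>0)) e≤ε)
    where
    c : ℝ
    c = Func.to h′ x

  derivativeAt-cong : ∀ {h k c e x} → (∀ y → Func.to h y ≈ Func.to k y) → c ≈ e →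
                      DerivativeAt h c x → DerivativeAt k e x
  derivativeAt-cong {x = x} p q = littleO-cong _ λ y →
    minus-cong (minus-cong (p y) (p x)) (*-cong q (≈-refl {displacement x y}))

  -- The increment is the remainder, of order o(d), plus the linear term `c * d`.
  increment-bigO : ∀ h c x → DerivativeAt h c x →
                   BigO (displacement x) (λ y → Func.to h y - Func.to h x)
  increment-bigO h c x der = bigO-cong (displacement x)
    (λ y → pointwise λ n → solve 2 (λ a b → a :- b :+ b := a) ≡.refl
      (seq (Func.to h y - Func.to h x) n) (seq (c * displacement x y) n))
    (bigO-+ (displacement x) (littleO⇒bigO (displacement x) der)
      (bigO-linear (displacement x) c))
    where open +-*-Solver

  infixl 6 _+ᶠ_
  infixl 7 _*ᶠ_

  _+ᶠ_ _*ᶠ_ : RealFunction I → RealFunction I → RealFunction I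
  h +ᶠ k = record { to   = λ x → Func.to h x + Func.to k x
                  ; cong = λ p → +-cong (Func.cong h p) (Func.cong k p) }
  h *ᶠ k = record { to   = λ x → Func.to h x * Func.to k x
                  ; cong = λ p → *-cong (Func.cong h p) (Func.cong k p) }

  +-derivativeAt : ∀ h k c e x → DerivativeAt h c x → DerivativeAt k e x →
                   DerivativeAt (h +ᶠ k) (c + e) x
  +-derivativeAt h k c e x p q = littleO-cong (displacement x)
    (λ y → pointwise λ n → solve 7 (λ h k h₀ k₀ c e d →
        (h :- h₀ :- c :* d) :+ (k :- k₀ :- e :* d) := (h :+ k) :- (h₀ :+ k₀) :- (c :+ e) :* d)
      ≡.refl (seq (Func.to h y) n) (seq (Func.to k y) n) (seq (Func.to h x) n)
      (seq (Func.to k x) n) (seq c n) (seq e n) (seq (displacement x y) n))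
    (littleO-+ (displacement x) p q)
    where open +-*-Solver

  -- The remainder of the product is the two remainders, each scaled by the other factor's value at
  -- `x`, plus the product of the increments, which is O(d) · O(d) = o(d).
  *-derivativeAt : ∀ h k c e x → DerivativeAt h c x → DerivativeAt k e x →
    DerivativeAt (h *ᶠ k) (c * Func.to k x + Func.to h x * e) x
  *-derivativeAt h k c e x p q = littleO-cong d
    (λ y → pointwise λ n → solve 7 (λ h k h₀ k₀ c e d →
        k₀ :* (h :- h₀ :- c :* d) :+ h₀ :* (k :- k₀ :- e :* d) :+ (h :- h₀) :* (k :- k₀) :=
        (h :* k) :- (h₀ :* k₀) :- (c :* k₀ :+ h₀ :* e) :* d)
      ≡.refl (seq (Func.to h y) n) (seq (Func.to k y) n) (seq (Func.to h x) n)
      (seq (Func.to k x) n) (seq c n) (seq e n) (seq (d y) n))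
    (littleO-+ d (littleO-+ d (littleO-scale d (Func.to k x) p) (littleO-scale d (Func.to h x) q))
      (bigO-*-bigO d (increment-bigO h c x p) (increment-bigO k e x q)))
    where
    open +-*-Solver
    d : Point I → ℝ
    d = displacement x

  -- Test points for the uniqueness of derivatives, at a positive rational distance that can be
  -- cancelled.
  point-near : ∀ x δ → 0ℚ ℚ.< δ → ∃ λ y → ∃ λ r →
               0ℚ ℚ.< r × r ℚ.≤ δ × displacement x y ≈ fromℚ r
  point-near (a , l , u) δ δ>0 = let (r , r>0 , r≤δ , u′) = above (upper I) u in
    (a + fromℚ r , below (lower I) r r>0 l , u′) , r , r>0 , r≤δ ,
    pointwise λ n → Identities.plus-minusˡ (seq a n) r
    where
    below : ∀ m r → 0ℚ ℚ.< r → All (_< a) m → All (_< a + fromℚ r) m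
    below nothing  r r>0 nothing  = nothing
    below (just b) r r>0 (just p) = just (<-≤-trans p (≤-pointwise λ n →
      ≡.subst (ℚ._≤ seq a n ℚ.+ r) (ℚ.+-identityʳ (seq a n))
        (ℚ.+-monoʳ-≤ (seq a n) (ℚ.<⇒≤ r>0))))

    above : ∀ m → All (a <_) m →
            ∃ λ r → 0ℚ ℚ.< r × r ℚ.≤ δ × All (a + fromℚ r <_) m
    above nothing  nothing = δ , δ>0 , ℚ.≤-refl , nothing
    -- At most half of the gap to the endpoint is spent on the displacement; the other half remains
    -- as the new gap.
    above (just b) (just (mk< g g>0 sep)) = δ ℚ.⊓ half g , ⊓-pos δ>0 (half-pos g g>0) ,
      ℚ.p⊓q≤p δ (half g) , just (mk< (half g) (half-pos g g>0) (eventually-map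
        (λ n → ℚ.≤-trans (ℚ.≤-trans
          (ℚ.+-monoˡ-≤ (half g) (ℚ.+-monoʳ-≤ (seq a n) (ℚ.p⊓q≤q δ (half g))))
          (ℚ.≤-reflexive (≡.trans (ℚ.+-assoc (seq a n) (half g) (half g))
            (≡.cong (seq a n ℚ.+_) (half+half g)))))) sep))

  -- For each `ε` a single test point at distance r gives ∣c∣ · r ≤ ε · r, and r cancels.
  linear-littleO⇒0 : ∀ c x → LittleO (displacement x) (λ y → c * displacement x y) → c ≈ 0ℝ
  linear-littleO⇒0 c x h = ∣∣≤⇒≈0 c λ ε ε>0 →
    let (δ , δ>0 , b)             = h ε ε>0
        (y , r , r>0 , r≤δ , d≈r) = point-near x δ δ>0
        (s , s>0 , rs≡1)          = inverse-of r r>0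
        ∣d∣≈r : ∣ displacement x y ∣ ≈ fromℚ r
        ∣d∣≈r = ≈-trans (∣∣-cong d≈r) (pointwise λ n → ℚ.0≤p⇒∣p∣≡p (ℚ.<⇒≤ r>0))
        cr≤εr : ∣ c ∣ * fromℚ r ≤ fromℚ ε * fromℚ r
        cr≤εr = ≤-respˡ (*-cong (≈-refl {∣ c ∣}) (≈-sym ∣d∣≈r))
          (≤-respˡ (≈-sym (∣*∣≈ c (displacement x y)))
          (≤-respʳ (b y (≤-respˡ ∣d∣≈r (fromℚ-mono r≤δ)))
            (*-cong (≈-refl {fromℚ ε}) ∣d∣≈r)))
        undo : ∀ p → p ℚ.* r ℚ.* s ≡ p
        undo p = ≡.trans (ℚ.*-assoc p r s)
          (≡.trans (≡.cong (p ℚ.*_) rs≡1) (ℚ.*-identityʳ p))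
    in ≤-respˡ (pointwise λ n → ≡.sym (undo (seq ∣ c ∣ n)))
         (≤-respʳ (*-monoʳ-≤ (fromℚ s) (fromℚ-nonNeg s>0) cr≤εr)
           (pointwise λ n → undo ε))

  derivativeAt-unique : ∀ h c e x → DerivativeAt h c x → DerivativeAt h e x → c ≈ e
  derivativeAt-unique h c e x p q = ≈-trans
    (pointwise λ n → solve 2 (λ c e → c := e :+ (c :- e)) ≡.refl (seq c n) (seq e n))
    (≈-trans
      (+-cong (≈-refl {e}) (linear-littleO⇒0 (c - e) x (littleO-cong (displacement x)
        (λ y → pointwise λ n → solve 4
          (λ b c e d → b :- e :* d :+ (:- con 1ℚ) :* (b :- c :* d) := (c :- e) :* d) ≡.refl
          (seq (Func.to h y - Func.to h x) n) (seq c n) (seq e n) (seq (displacement x y) n))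
        (littleO-+ (displacement x) q (littleO-scale (displacement x) (- 1ℝ) p)))))
      (pointwise λ n → ℚ.+-identityʳ (seq e n)))
    where open +-*-Solver

-- The remainder splits into that of `g` at `f y`, small because the increment of `f` is O(d), and
-- `e` times that of `f`.
∘-derivativeAt : ∀ {I J} (f : Func ⟦ I ⟧ ⟦ J ⟧) (g : RealFunction J) c e x →
  DerivativeAt (inclusion J ∘ f) c x → DerivativeAt g e (Func.to f x) →
  DerivativeAt (g ∘ f) (e * c) x
∘-derivativeAt {I} {J} f g c e x p q = littleO-cong d
  (λ y → pointwise λ n → solve 5
    (λ b u c e d → (b :- e :* u) :+ e :* (u :- c :* d) := b :- e :* c :* d) ≡.refl
    (seq (Func.to g (Func.to f y) - Func.to g (Func.to f x)) n)
    (seq (displacement (Func.to f x) (Func.to f y)) n) (seq c n) (seq e n) (seq (d y) n))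
  (littleO-+ d
    (littleO-∘ d (displacement {J} (Func.to f x)) (Func.to f) {remainder g e (Func.to f x)} q
      (increment-bigO (inclusion J ∘ f) c x p))
    (littleO-scale d e p))
  where
  open +-*-Solver
  d : Point I → ℝ
  d = displacement x

-- Compositae as coefficients of powers

open PowerSeries ℝ-semiring

private module ℝₛ = CommutativeSemiring ℝ-semiring

suc-/1 : ∀ n → 1ℚ ℚ.+ (+ n) ℚ./ 1 ≡ (+ suc n) ℚ./ 1
suc-/1 n = ℚ.toℚᵘ-injective (begin
  ℚ.toℚᵘ (1ℚ ℚ.+ (+ n) ℚ./ 1)         ≈⟨ ℚ.toℚᵘ-homo-+ 1ℚ ((+ n) ℚ./ 1) ⟩
  ℚ.toℚᵘ 1ℚ ℚᵘ.+ ℚ.toℚᵘ ((+ n) ℚ./ 1)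
    ≈⟨ ℚᵘ.+-cong (ℚᵘ.≃-refl {ℚ.toℚᵘ 1ℚ}) (ℚ.toℚᵘ-fromℚᵘ (mkℚᵘ (+ n) 0)) ⟩
  ℚ.toℚᵘ 1ℚ ℚᵘ.+ mkℚᵘ (+ n) 0
    ≈⟨ *≡* (≡.cong (ℤ._* (+ 1)) (≡.cong (λ z → (+ 1) ℤ.+ z) (ℤ.*-identityʳ (+ n)))) ⟩
  mkℚᵘ (+ suc n) 0                    ≈⟨ ℚ.toℚᵘ-fromℚᵘ (mkℚᵘ (+ suc n) 0) ⟨
  ℚ.toℚᵘ ((+ suc n) ℚ./ 1)            ∎)
  where open import Relation.Binary.Reasoning.Setoid ℚᵘ.≃-setoid

-- The denominator has the shape to which `(suc n) !` unfolds.
/1-*-1/ : ∀ a d .{{_ : ℕ.NonZero d}} .{{_ : ℕ.NonZero (suc a ℕ.* d)}} →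
          (+ suc a) ℚ./ 1 ℚ.* ((+ 1) ℚ./ (suc a ℕ.* d)) ≡ (+ 1) ℚ./ d
/1-*-1/ a (suc d) = ℚ.toℚᵘ-injective (begin
  ℚ.toℚᵘ ((+ suc a) ℚ./ 1 ℚ.* ((+ 1) ℚ./ (suc a ℕ.* suc d)))
    ≈⟨ ℚ.toℚᵘ-homo-* ((+ suc a) ℚ./ 1) ((+ 1) ℚ./ (suc a ℕ.* suc d)) ⟩
  ℚ.toℚᵘ ((+ suc a) ℚ./ 1) ℚᵘ.* ℚ.toℚᵘ ((+ 1) ℚ./ (suc a ℕ.* suc d))
    ≈⟨ ℚᵘ.*-cong (ℚ.toℚᵘ-fromℚᵘ (mkℚᵘ (+ suc a) 0))
         (ℚ.toℚᵘ-fromℚᵘ (mkℚᵘ (+ 1) (d ℕ.+ a ℕ.* suc d))) ⟩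
  mkℚᵘ (+ suc a) 0 ℚᵘ.* mkℚᵘ (+ 1) (d ℕ.+ a ℕ.* suc d)
    ≈⟨ *≡* (≡.cong +_ (≡.trans
         (≡.cong (ℕ._* suc d) (ℕ.*-identityʳ (suc a)))
         (≡.sym (≡.trans (ℕ.*-identityˡ _) (ℕ.*-identityˡ _))))) ⟩
  mkℚᵘ (+ 1) d
    ≈⟨ ℚ.toℚᵘ-fromℚᵘ (mkℚᵘ (+ 1) d) ⟨
  ℚ.toℚᵘ ((+ 1) ℚ./ suc d) ∎)
  where open import Relation.Binary.Reasoning.Setoid ℚᵘ.≃-setoid

seq-fromℕ : ∀ n k → seq (fromℕ n) k ≡ (+ n) ℚ./ 1
seq-fromℕ zero    k = ≡.refl
seq-fromℕ (suc n) k = ≡.trans (≡.cong (1ℚ ℚ.+_) (seq-fromℕ n k)) (suc-/1 n)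

invFactorial-zero : invFactorial 0 ≈ 1ℝ
invFactorial-zero = pointwise λ _ → ≡.refl

invFactorial-suc : ∀ n → fromℕ (suc n) * invFactorial (suc n) ≈ invFactorial n
invFactorial-suc n = pointwise λ k → ≡.trans
  (≡.cong (ℚ._* seq (invFactorial (suc n)) k) (seq-fromℕ (suc n) k))
  (/1-*-1/ n (n !) {{n ℕ.!≢0}} {{suc n ℕ.!≢0}})

fromℕ-cancel : ∀ n x y → fromℕ (suc n) * x ≈ fromℕ (suc n) * y → x ≈ y
fromℕ-cancel n x y e = ≈-trans (≈-sym (undo x)) (≈-trans (*-cong (≈-refl {r}) e) (undo y))
  where
  r : ℝ
  -- The factor 1 in the denominator fits `/1-*-1/` with `d` = 1.
  r = fromℚ ((+ 1) ℚ./ (suc n ℕ.* 1))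
  r*n : r * fromℕ (suc n) ≈ 1ℝ
  r*n = pointwise λ k → ≡.trans (ℚ.*-comm (seq r k) (seq (fromℕ (suc n)) k))
    (≡.trans (≡.cong (ℚ._* seq r k) (seq-fromℕ (suc n) k)) (/1-*-1/ n 1))
  undo : ∀ z → r * (fromℕ (suc n) * z) ≈ z
  undo z = ≈-trans (≈-sym (ℝₛ.*-assoc r (fromℕ (suc n)) z))
    (≈-trans (*-cong r*n (≈-refl {z})) (ℝₛ.*-identityˡ z))

sumℝ-++ : ∀ xs ys → sumℝ (xs ++ ys) ≈ sumℝ xs + sumℝ ys
sumℝ-++ []       ys = ≈-sym (ℝₛ.+-identityˡ (sumℝ ys))
sumℝ-++ (x ∷ xs) ys = ≈-trans (+-cong (≈-refl {x}) (sumℝ-++ xs ys))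
  (≈-sym (ℝₛ.+-assoc x (sumℝ xs) (sumℝ ys)))

sumℝ-map-concatMap : {A B : Set} (p : B → ℝ) (h : A → List B) (xs : List A) →
  sumℝ (List.map p (concatMap h xs)) ≈ sumℝ (List.map (λ x → sumℝ (List.map p (h x))) xs)
sumℝ-map-concatMap p h []       = ≈-refl
sumℝ-map-concatMap p h (x ∷ xs) = ≈-trans
  (ℝₛ.reflexive (≡.cong sumℝ (List.map-++ p (h x) (concatMap h xs))))
  (≈-trans (sumℝ-++ (List.map p (h x)) (List.map p (concatMap h xs)))
    (+-cong (≈-refl {sumℝ (List.map p (h x))}) (sumℝ-map-concatMap p h xs)))

sumℝ-applyUpTo : ∀ (t : ℕ → ℝ) (f : ℕ → ℕ) n →
  sumℝ (List.map t (applyUpTo f (suc n))) ≈ ∑ n (λ i → t (f i))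
sumℝ-applyUpTo t f zero    = ℝₛ.+-identityʳ (t (f 0))
sumℝ-applyUpTo t f (suc n) =
  +-cong (≈-refl {t (f 0)}) (sumℝ-applyUpTo t (λ i → f (suc i)) n)

-- Dropping a vanishing leading term lowers both bounds of `sumFromTo` by one, by definition.
∑≈sumFromTo : ∀ t {m n} → m ℕ.≤ n → (∀ k → k ℕ.< m → t k ≈ 0ℝ) → ∑ n t ≈ sumFromTo m n t
∑≈sumFromTo t {n = n} ℕ.z≤n z = ≈-sym (sumℝ-applyUpTo t id n)
∑≈sumFromTo t (ℕ.s≤s {m} {n} l) z = ≈-trans
  (+-cong (z 0 (ℕ.s≤s ℕ.z≤n)) (∑≈sumFromTo (tail t) l (λ k q → z (suc k) (ℕ.s≤s q))))
  (ℝₛ.+-identityˡ (sumFromTo m n (tail t)))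

⊛-∑-∸ : ∀ A B n → (A ⊛ B) n ≈ ∑ n (λ i → A i * B (n ∸ i))
⊛-∑-∸ A B zero    = ≈-refl
⊛-∑-∸ A B (suc n) = +-cong (≈-refl {A 0 * B (suc n)}) (⊛-∑-∸ (tail A) B n)

compositionSum : (ℕ → ℝ) → ℕ → ℕ → ℝ
compositionSum a n k =
  sumℝ (List.map (λ parts → productℝ (Vec.map a parts)) (compositions n k))

-- Sorting compositions by their first part `suc i` leaves `n ∸ i` for the others: a convolution.
compositionSum-suc : ∀ a n k → compositionSum a (suc n) (suc k) ≈
  ∑ n (λ i → a (suc i) * compositionSum a (n ∸ i) k)
compositionSum-suc a n k = ≈-trans
  (sumℝ-map-concatMap P (λ i → List.map (suc i Vec.∷_) (compositions (n ∸ i) k)) (upTo (suc n)))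
  (≈-trans (sumℝ-applyUpTo S id n)
    (∑-cong n S (λ i → a (suc i) * compositionSum a (n ∸ i) k)
      (λ i → factor i (compositions (n ∸ i) k))))
  where
  P : ∀ {k} → Vec ℕ k → ℝ
  P v = productℝ (Vec.map a v)
  S : ℕ → ℝ
  S i = sumℝ (List.map P (List.map (suc i Vec.∷_) (compositions (n ∸ i) k)))
  factor : ∀ i vs → sumℝ (List.map P (List.map (suc i Vec.∷_) vs)) ≈
                    a (suc i) * sumℝ (List.map (P {k}) vs)
  factor i []       = ≈-sym (ℝₛ.zeroʳ (a (suc i)))
  factor i (v ∷ vs) = ≈-trans (+-cong (≈-refl {a (suc i) * P v}) (factor i vs))
    (≈-sym (ℝₛ.distribˡ (a (suc i)) (P v) (sumℝ (List.map P vs))))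

-- The two descriptions of the composita agree by the same recursion in k. Since parts are positive,
-- `shift (tail a)` puts zero in place of the constant term.
compositionSum-power : ∀ a n k → compositionSum a n k ≈ (shift (tail a) ^ˢ k) n
compositionSum-power a zero    zero    = ℝₛ.+-identityʳ 1ℝ
compositionSum-power a (suc n) zero    = ≈-refl
compositionSum-power a zero    (suc k) = ≈-sym (ℝₛ.zeroˡ ((shift (tail a) ^ˢ k) 0))
compositionSum-power a (suc n) (suc k) = ≈-trans (compositionSum-suc a n k) (≈-trans
  (∑-cong n (λ i → a (suc i) * compositionSum a (n ∸ i) k) (λ i → a (suc i) * power (n ∸ i))
    (λ i → *-cong (≈-refl {a (suc i)}) (compositionSum-power a (n ∸ i) k)))
  (≈-trans (≈-sym (⊛-∑-∸ (tail a) power n))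
    (≈-sym (⊛-shiftˡ (tail a) power (suc n)))))
  where
  power : ℕ → ℝ
  power = shift (tail a) ^ˢ k

-- Derivatives and composita of the composite function

deriv-unique : ∀ {I} {h : RealFunction I} (Y Z : InfinitelyDifferentiable h) n x →
               Func.to (deriv Y n) x ≈ Func.to (deriv Z n) x
deriv-unique Y Z zero    x = ≈-trans (deriv-zero Y x) (≈-sym (deriv-zero Z x))
deriv-unique Y Z (suc n) x = derivativeAt-unique (deriv Z n)
  (Func.to (deriv Y (suc n)) x) (Func.to (deriv Z (suc n)) x) x
  (derivativeAt-cong {h = deriv Y n} {k = deriv Z n} (deriv-unique Y Z n) ≈-refl
    (hasDerivative⇒at {h = deriv Y n} {h′ = deriv Y (suc n)} (deriv-suc Y n) x))
  (hasDerivative⇒at {h = deriv Z n} {h′ = deriv Z (suc n)} (deriv-suc Z n) x)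

module Composite {I J : OpenInterval} (f : Func ⟦ I ⟧ ⟦ J ⟧) (g : RealFunction J)
  (F : InfinitelyDifferentiable (inclusion J ∘ f)) (G : InfinitelyDifferentiable g) where

  interpret : DiffPoly → RealFunction I
  interpret (outer j) = deriv G j ∘ f
  interpret (inner i) = deriv F i
  interpret (p ⊕ q)   = interpret p +ᶠ interpret q
  interpret (p ⊗ q)   = interpret p *ᶠ interpret q

  interpret-derivativeAt : ∀ p x →
    DerivativeAt (interpret p) (Func.to (interpret (D p)) x) x
  interpret-derivativeAt (outer j) x = ∘-derivativeAt f (deriv G j) _ _ x
    -- The record `F` differentiates `deriv F 0`, which agrees with `f` only up to `≈`.
    (derivativeAt-cong {h = deriv F 0} {k = inclusion J ∘ f} (deriv-zero F) ≈-refl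
      (hasDerivative⇒at {h = deriv F 0} {h′ = deriv F 1} (deriv-suc F 0) x))
    (hasDerivative⇒at {h = deriv G j} {h′ = deriv G (suc j)} (deriv-suc G j) (Func.to f x))
  interpret-derivativeAt (inner i) x =
    hasDerivative⇒at {h = deriv F i} {h′ = deriv F (suc i)} (deriv-suc F i) x
  interpret-derivativeAt (p ⊕ q) x = +-derivativeAt (interpret p) (interpret q) _ _ x
    (interpret-derivativeAt p x) (interpret-derivativeAt q x)
  interpret-derivativeAt (p ⊗ q) x = *-derivativeAt (interpret p) (interpret q) _ _ x
    (interpret-derivativeAt p x) (interpret-derivativeAt q x)

  interpret-hasDerivative : ∀ n p →
    interpret (D^ n p) HasDerivative interpret (D^ (suc n) p)
  interpret-hasDerivative zero    p =
    at⇒hasDerivative {h = interpret p} {h′ = interpret (D p)} (interpret-derivativeAt p)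
  interpret-hasDerivative (suc n) p = interpret-hasDerivative n (D p)

  composite : InfinitelyDifferentiable (g ∘ f)
  composite = record
    { deriv      = λ n → interpret (D^ n (outer 0))
    ; deriv-zero = λ x → deriv-zero G (Func.to f x)
    ; deriv-suc  = λ n → interpret-hasDerivative n (outer 0)
    }

  module _ (x : Point I) where

    open FaàDiBruno ℝ-semiring invFactorial
      (λ j → Func.to (deriv G j) (Func.to f x)) (λ i → Func.to (deriv F i) x)

    interpret-eval : ∀ p → Func.to (interpret p) x ≡ eval p
    interpret-eval (outer j) = ≡.refl
    interpret-eval (inner i) = ≡.refl
    interpret-eval (p ⊕ q)   = ≡.cong₂ _+_ (interpret-eval p) (interpret-eval q)
    interpret-eval (p ⊗ q)   = ≡.cong₂ _*_ (interpret-eval p) (interpret-eval q)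

    Ĝ F̂ : Series
    Ĝ = shift (tail (outerSeries 0))
    F̂ = shift innerTail

    -- In positive degree a composite depends only on the tail of its outer series, so removing the
    -- constant term of the outer series removes just that of the composite.
    coefficient-compose : ∀ Y →
      shift (tail (λ n → coefficient Y n x)) ≋ compose Ĝ innerTail
    coefficient-compose Y zero    = ≈-sym (ℝₛ.zeroˡ 1ℝ)
    coefficient-compose Y (suc n) = begin
      Func.to (deriv Y (suc n)) x * invFactorial (suc n)
        ≈⟨ *-cong (deriv-unique Y composite (suc n) x) (≈-refl {invFactorial (suc n)}) ⟩
      Func.to (interpret (D^ (suc n) (outer 0))) x * invFactorial (suc n)
        ≡⟨ ≡.cong (_* invFactorial (suc n)) (interpret-eval (D^ (suc n) (outer 0))) ⟩
      taylor (outer 0) (suc n)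
        ≈⟨ taylor-outer invFactorial-zero invFactorial-suc fromℕ-cancel 0 (suc n) ⟩
      compose (outerSeries 0) innerTail (suc n)
        ≈⟨ compose-suc (outerSeries 0) innerTail n ⟩
      (innerTail ⊛ compose (tail (outerSeries 0)) innerTail) n
        ≈⟨ compose-suc Ĝ innerTail n ⟨
      compose Ĝ innerTail (suc n) ∎
      where open import Relation.Binary.Reasoning.Setoid ℝ-setoid

    -- The m-th power of the composite is the composite of `Ĝ ^ˢ m`, whose coefficient, by
    -- definition of `compose`, is already the sum over k of coefficients of powers.
    composita-compose : ∀ Y n m → m ℕ.≤ n → composita Y n m x ≈
      sumFromTo m n (λ k → composita F n k x * composita G k m (Func.to f x))
    composita-compose Y n m m≤n = begin
      composita Y n m x
        ≈⟨ compositionSum-power (λ i → coefficient Y i x) n m ⟩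
      (shift (tail (λ i → coefficient Y i x)) ^ˢ m) n
        ≈⟨ ^ˢ-cong _ (compose Ĝ innerTail) m (coefficient-compose Y) n ⟩
      (compose Ĝ innerTail ^ˢ m) n
        ≈⟨ compose-^ˢ Ĝ innerTail m n ⟨
      ∑ n (λ k → (Ĝ ^ˢ m) k * (F̂ ^ˢ k) n)
        ≈⟨ ∑-cong n _ t (λ k → ≈-trans (ℝₛ.*-comm ((Ĝ ^ˢ m) k) ((F̂ ^ˢ k) n))
             (≈-sym (*-cong (powerF k) (powerG k)))) ⟩
      ∑ n t
        -- The sum starts at 0; its terms with k < m vanish because `Ĝ ^ˢ m` is divisible by the
        -- m-th power of its variable.
        ≈⟨ ∑≈sumFromTo t m≤n (λ k k<m → ≈-trans
             (*-cong (≈-refl {composita F n k x})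
               (≈-trans (powerG k) (^ˢ-vanish (tail (outerSeries 0)) m k k<m)))
             (ℝₛ.zeroʳ (composita F n k x))) ⟩
      sumFromTo m n t ∎
      where
      open import Relation.Binary.Reasoning.Setoid ℝ-setoid
      t : ℕ → ℝ
      t k = composita F n k x * composita G k m (Func.to f x)
      powerF : ∀ k → composita F n k x ≈ (F̂ ^ˢ k) n
      powerF = compositionSum-power (λ i → coefficient F i x) n
      powerG : ∀ k → composita G k m (Func.to f x) ≈ (Ĝ ^ˢ m) k
      powerG k = compositionSum-power (λ i → coefficient G i (Func.to f x)) k m

theorem3p6 : (I J : OpenInterval) (f : Func ⟦ I ⟧ ⟦ J ⟧) (g : RealFunction J)
    (F : InfinitelyDifferentiable (inclusion J ∘ f))
    (G : InfinitelyDifferentiable g) →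
    InfinitelyDifferentiable (g ∘ f) ×
    ((Y : InfinitelyDifferentiable (g ∘ f)) (n m : ℕ) → 1 ℕ.≤ m → m ℕ.≤ n →
    (x : Point I) →
    composita Y n m x ≈
    sumFromTo m n (λ k → composita F n k x * composita G k m (Func.to f x)))
theorem3p6 I J f g F G = composite , λ Y n m _ m≤n x → composita-compose x Y n m m≤n
  where open Composite f g F G
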